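{- For every natural number $k\geq 2$, $\mathcal{TC}(\mathrm{SLT}_k)=\mathrm{CS}$, and moreover $\mathcal{TC}(\mathrm{SLT})=\mathrm{CS}$.
   Context: $\mathrm{CS}$ denotes the family of context-sensitive languages. A tree-controlled grammar is a quintuple $G=(N,T,P,S,R)$ where $(N,T,P,S)$ is a context-free grammar whose rules are all non-erasing (the only exception being that $S\to\lambda$ is allowed if $S$ does not occur on the right-hand side of any rule), and $R$ is a regular language over $N\cup T$. For a derivation tree, the word of level $j$ is the word formed by all nodes of depth $j$ read from left to right. The language $L(G)$ consists of all $z\in T^*$ having a derivation tree $t$ whose leaves read from left to right give $z$ and such that the words of all levels of $t$, except the last level, belong to $R$. For a family $\mathcal{F}$ of regular languages, $\mathcal{TC}(\mathcal{F})$ is the family of languages $L(G)$ of tree-controlled grammars $G=(N,T,P,S,R)$ with $R\in\mathcal{F}$. For $k\geq1$, a language $L$ over an alphabet $V$ is strictly locally $k$-testable (family $\mathrm{SLT}_k$) if there are sets $B,I,E\subseteq V^k$ and a finite set $F$ of words of length at most $k-1$ such that $L$ consists of the words of $F$ together with exactly those words $a_1a_2\cdots a_n$ ($n\geq k$, $a_i\in V$) for which $a_1\cdots a_k\in B$, $a_{j+1}\cdots a_{j+k}\in I$ for every $j$ with $1\leq j\leq n-k-1$, and $a_{n-k+1}\cdots a_n\in E$. $\mathrm{SLT}=\bigcup_{k\geq1}\mathrm{SLT}_k$. -}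

module Defs where

open import Data.Nat using (ℕ; zero; suc; _≤_; _<_; _⊔_; _≤?_)
open import Relation.Nullary using (yes; no)
open import Data.Fin using (Fin)
open import Data.List using (List; []; _∷_; _++_; length; take; drop; reverse; map)
open import Data.List.Relation.Unary.All using (All)
open import Data.List.Membership.Propositional using (_∈_; _∉_)
open import Data.Sum using (_⊎_; inj₁; inj₂)
open import Data.Product using (Σ; _×_; _,_; proj₁; proj₂)
open import Data.Unit using (⊤)
open import Relation.Binary.PropositionalEquality using (_≡_; _≢_)
open import Relation.Binary.Construct.Closure.ReflexiveTransitive using (Star)
open import Function.Bundles using (_⇔_)

-- Symbols: nonterminals Fin n, terminals Fin t; V = N ∪ T

Sym : ℕ → ℕ → Set
Sym n t = Fin n ⊎ Fin t

windows : {A : Set} → ℕ → List A → List (List A)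
windows k [] = []
windows k (a ∷ w) with k ≤? length (a ∷ w)
... | yes _ = take k (a ∷ w) ∷ windows k w
... | no _ = []

dropLast : {A : Set} → List A → List A
dropLast [] = []
dropLast (x ∷ []) = []
dropLast (x ∷ y ∷ r) = x ∷ dropLast (y ∷ r)

record SLTDesc (V : Set) (k : ℕ) : Set where
  field
    B I E : List (List V)
    F : List (List V)
    B-len : All (λ u → length u ≡ k) B
    I-len : All (λ u → length u ≡ k) I
    E-len : All (λ u → length u ≡ k) E
    F-len : All (λ u → length u < k) F

InSLT : {V : Set} {k : ℕ} → SLTDesc V k → List V → Set
InSLT {V} {k} D w =
  w ∈ F ⊎
  (k ≤ length w
   × All (_∈ B) (take 1 (windows k w))
   × All (_∈ E) (take 1 (reverse (windows k w)))
   × All (_∈ I) (dropLast (drop 1 (windows k w))))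
  where open SLTDesc D

Rule : ℕ → ℕ → Set
Rule n t = Fin n × List (Sym n t)

data Tree (n t : ℕ) : Set where
  leaf : Fin t → Tree n t
  node : Fin n → List (Tree n t) → Tree n t

label : {n t : ℕ} → Tree n t → Sym n t
label (leaf a) = inj₂ a
label (node A _) = inj₁ A

labels : {n t : ℕ} → List (Tree n t) → List (Sym n t)
labels [] = []
labels (x ∷ xs) = label x ∷ labels xs

mutual
  yield : {n t : ℕ} → Tree n t → List (Fin t)
  yield (leaf a) = a ∷ []
  yield (node A ts) = yields ts

  yields : {n t : ℕ} → List (Tree n t) → List (Fin t)
  yields [] = []
  yields (x ∷ xs) = yield x ++ yields xs

mutual
  Valid : {n t : ℕ} → List (Rule n t) → Tree n t → Set
  Valid P (leaf a) = ⊤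
  Valid P (node A ts) = ((A , labels ts) ∈ P) × ValidAll P ts

  ValidAll : {n t : ℕ} → List (Rule n t) → List (Tree n t) → Set
  ValidAll P [] = ⊤
  ValidAll P (x ∷ xs) = Valid P x × ValidAll P xs

mutual
  -- depth of the tree; a node with no children (rule S → λ) has a
  -- λ-leaf below it, so it counts as height 1
  height : {n t : ℕ} → Tree n t → ℕ
  height (leaf a) = 0
  height (node A ts) = suc (heights ts)

  heights : {n t : ℕ} → List (Tree n t) → ℕ
  heights [] = 0
  heights (x ∷ xs) = height x ⊔ heights xs

mutual
  level : {n t : ℕ} → ℕ → Tree n t → List (Sym n t)
  level zero x = label x ∷ []
  level (suc j) (leaf a) = []
  level (suc j) (node A ts) = levels j ts

  levels : {n t : ℕ} → ℕ → List (Tree n t) → List (Sym n t)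
  levels j [] = []
  levels j (x ∷ xs) = level j x ++ levels j xs

record TCGrammarSLT (n t k : ℕ) : Set where
  field
    P : List (Rule n t)
    S : Fin n
    nonErasing : All (λ r → proj₂ r ≢ [] ⊎
                   (proj₁ r ≡ S × All (λ r' → inj₁ S ∉ proj₂ r') P)) P
    R : SLTDesc (Sym n t) k

TCLang : {n t k : ℕ} → TCGrammarSLT n t k → List (Fin t) → Set
TCLang {n} {t} G z =
  Σ (Tree n t) λ tr →
    label tr ≡ inj₁ S × Valid P tr × yield tr ≡ z ×
    ((j : ℕ) → j < height tr → InSLT R (level j tr))
  where open TCGrammarSLT G

record CSRule (m t : ℕ) : Set where
  constructor csrule
  field
    left  : List (Sym m t)
    A     : Fin m
    right : List (Sym m t)
    γ     : List (Sym m t)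

csLhs : {m t : ℕ} → CSRule m t → List (Sym m t)
csLhs r = CSRule.left r ++ inj₁ (CSRule.A r) ∷ CSRule.right r

csRhs : {m t : ℕ} → CSRule m t → List (Sym m t)
csRhs r = CSRule.left r ++ CSRule.γ r ++ CSRule.right r

record CSGrammar (m t : ℕ) : Set where
  field
    P : List (CSRule m t)
    S : Fin m
    wf : All (λ r → CSRule.γ r ≢ [] ⊎
           (CSRule.A r ≡ S × CSRule.left r ≡ [] × CSRule.right r ≡ [] ×
            All (λ r' → inj₁ S ∉ csRhs r') P)) P

data Step {m t : ℕ} (G : CSGrammar m t) : List (Sym m t) → List (Sym m t) → Set where
  step : (x y : List (Sym m t)) (r : CSRule m t) → r ∈ CSGrammar.P G →
         Step G (x ++ csLhs r ++ y) (x ++ csRhs r ++ y)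

CSLang : {m t : ℕ} → CSGrammar m t → List (Fin t) → Set
CSLang G w = Star (Step G) (inj₁ (CSGrammar.S G) ∷ []) (map inj₂ w)

InTC-SLTk : ℕ → (t : ℕ) → (List (Fin t) → Set) → Set
InTC-SLTk k t L = Σ ℕ λ n → Σ (TCGrammarSLT n t k) λ G → (z : List (Fin t)) → L z ⇔ TCLang G z

InTC-SLT : (t : ℕ) → (List (Fin t) → Set) → Set
InTC-SLT t L = Σ ℕ λ k → 1 ≤ k × InTC-SLTk k t L

InCS : (t : ℕ) → (List (Fin t) → Set) → Set
InCS t L = Σ ℕ λ m → Σ (CSGrammar m t) λ G → (z : List (Fin t)) → L z ⇔ CSLang G z

{-# OPTIONS --safe #-}
-- TC(SLT_k) ⊆ CS: a derivation tree is a sequence of cuts, each obtained from the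
-- previous one by expanding every node of the current level.  A strictly locally
-- testable language is regular, so a machine with one head can expand a cut and
-- check its level in a single sweep; the tape never shrinks, because apart from
-- S → λ the rules are non-erasing, and so the machine is a context-sensitive grammar.
--
-- CS ⊆ TC(SLT_k) for k ≥ 2: every level of the tree is a sentential form.  To apply a
-- rule, the symbols of an occurrence of its left-hand side are first marked by
-- the rule and their position in it, and rewritten one level later.  That marked
-- occurrences are complete is a condition on adjacent symbols, and terminals are
-- barred from the controlled levels, so they can only appear in the last one.
module Submission where

open import Defs
open import Data.Nat using (ℕ; _≤_)
open import Data.Fin using (Fin)
open import Data.List using (List)
open import Data.Product using (_×_)
open import Function.Bundles using (_⇔_)
open import Data.Bool using (Bool; true; false; T; not; _∧_)
open import Data.Bool.Properties using (T-∧; T-≡; ¬-not)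
open import Data.Empty using (⊥; ⊥-elim)
open import Data.Fin using (zero; suc; toℕ)
import Data.Fin.Properties as Fin
open import Data.List
  using ([]; _∷_; _++_; _ʳ++_; allFin; concatMap; drop; filter; foldr; length; lookup; map; null; reverse; tabulate; take)
import Data.List.Properties as List
open import Data.List.Membership.Propositional using (_∈_; _∉_)
open import Data.List.Membership.Propositional.Properties
  using (∈-++⁺ˡ; ∈-++⁺ʳ; ∈-++⁻; ∈-allFin; ∈-concatMap⁺; ∈-filter⁺; ∈-filter⁻; ∈-lookup; ∈-map⁺; ∈-map⁻)
import Data.List.Membership.DecPropositional as DecMembership
open import Data.List.Relation.Unary.All using (All; []; _∷_)
import Data.List.Relation.Unary.All as All
import Data.List.Relation.Unary.All.Properties as All
open import Data.List.Relation.Unary.Any using (here; there; index)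
import Data.List.Relation.Unary.Any as Any
open import Data.List.Relation.Unary.Any.Properties using (lookup-index)
open import Data.Maybe using (Maybe; just; nothing)
open import Data.Nat using (zero; suc; pred; _<_; _<ᵇ_; _⊔_; _≤?_; _<?_; z≤n; s≤s)
import Data.Nat.Properties as ℕ
open import Data.Product using (Σ; ∃; _,_; proj₁; proj₂)
import Data.Product.Properties as Product
open import Data.Sum using (_⊎_; inj₁; inj₂; [_,_]′)
import Data.Sum as Sum
open import Data.Sum.Properties using (inj₂-injective)
open import Data.Unit using (⊤; tt)
open import Function using (_∘_; id)
open import Function.Bundles using (mk⇔; Equivalence)
open import Function.Construct.Composition using (_⇔-∘_)
open import Function.Construct.Symmetry using (⇔-sym)
open import Relation.Binary using (DecidableEquality)
open import Relation.Binary.Construct.Closure.ReflexiveTransitive using (Star; ε; _◅_; _◅◅_)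
import Relation.Binary.Construct.Closure.ReflexiveTransitive as Star
open import Relation.Binary.PropositionalEquality
  using (_≡_; _≢_; refl; sym; trans; cong; cong₂; subst; subst₂)
open import Relation.Nullary using (Dec; yes; no; ¬_)
open import Relation.Nullary.Decidable using (⌊_⌋; toWitness; fromWitness; T?; map′; _×-dec_; _⊎-dec_)
open import Relation.Unary using (Decidable)

-- Finite types

-- A machine move changes two adjacent symbols at once, while a context-sensitive rule changes a
-- single nonterminal. `PairGrammar` is the form in between, and the passage from it to
-- context-sensitive rules must keep half-executed rules from interfering; this is shown by giving
-- every intermediate word a meaning, without reordering derivations. In a given tree-controlled
-- grammar terminals may lie on inner levels. They belong to the yield but to no later level, so a
-- cut keeps them in cells that the automaton skips. The empty word is treated apart in both
-- inclusions. An erased node can only be the root, so the tree of λ is a root alone, and its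
-- existence is decidable. Conversely, a context-sensitive derivation that erases can only end in λ,
-- and every other one uses non-erasing rules alone. The bound 2 on `k` lets a window see two
-- adjacent symbols; for larger `k` the same adjacency condition is tested inside the longer
-- windows, and the finitely many shorter words are listed.

record Listable (A : Set) : Set where
  field
    elems    : List A
    complete : ∀ a → a ∈ elems

  size : ℕ
  size = length elems

  code : A → Fin size
  code a = index (complete a)

  decode : Fin size → A
  decode = lookup elems

  -- `elems` may list an element several times, so a number need not be a `code`. Only this half of
  -- the bijection holds, and coded grammars are therefore analysed by decoding.
  decode-code : ∀ a → decode (code a) ≡ a
  decode-code a = sym (lookup-index (complete a))

  code-injective : ∀ {a b} → code a ≡ code b → a ≡ b
  code-injective {a} {b} e =
    trans (sym (decode-code a)) (trans (cong decode e) (decode-code b))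

  _≟_ : DecidableEquality A
  a ≟ b = map′ code-injective (cong code) (code a Fin.≟ code b)

open Listable public using (elems; complete)

listable-Fin : ∀ n → Listable (Fin n)
listable-Fin n = record { elems = allFin n ; complete = ∈-allFin }

listable-⊤ : Listable ⊤
listable-⊤ = record { elems = tt ∷ [] ; complete = λ _ → here refl }

listable-T : ∀ b → Listable (T b)
listable-T true  = listable-⊤
listable-T false = record { elems = [] ; complete = λ () }

listable-Bool : Listable Bool
listable-Bool = record
  { elems = true ∷ false ∷ []
  ; complete = λ { true → here refl ; false → there (here refl) } }

listable-Σ : {A : Set} {B : A → Set} → Listable A → (∀ a → Listable (B a)) → Listable (Σ A B)
listable-Σ {A} {B} lA lB = record
  { elems = concatMap fibre (elems lA)
  ; complete = λ { (a , b) →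
      ∈-concatMap⁺ fibre (Any.map (λ { refl → ∈-map⁺ (a ,_) (complete (lB a) b) }) (complete lA a)) } }
  where
  fibre : A → List (Σ A B)
  fibre a = map (a ,_) (elems (lB a))

listable-× : {A B : Set} → Listable A → Listable B → Listable (A × B)
listable-× lA lB = listable-Σ lA λ _ → lB

listable-⊎ : {A B : Set} → Listable A → Listable B → Listable (A ⊎ B)
listable-⊎ lA lB = record
  { elems = map inj₁ (elems lA) ++ map inj₂ (elems lB)
  ; complete = λ { (inj₁ a) → ∈-++⁺ˡ (∈-map⁺ inj₁ (complete lA a))
                 ; (inj₂ b) → ∈-++⁺ʳ _ (∈-map⁺ inj₂ (complete lB b)) } }

listable-image : {A B : Set} (f : A → B) → (∀ b → ∃ λ a → f a ≡ b) → Listable A → Listable B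
listable-image f surj lA = record
  { elems = map f (elems lA)
  ; complete = λ b → subst (_∈ map f (elems lA)) (proj₂ (surj b)) (∈-map⁺ f (complete lA (proj₁ (surj b)))) }

listable-Maybe : {A : Set} → Listable A → Listable (Maybe A)
listable-Maybe lA = record
  { elems = nothing ∷ map just (elems lA)
  ; complete = λ { nothing → here refl ; (just a) → there (∈-map⁺ just (complete lA a)) } }

-- Context-sensitive rewriting

map-[] : ∀ {A B : Set} (f : A → B) xs → map f xs ≡ [] → xs ≡ []
map-[] f [] _ = refl

data Rewrite {V : Set} (R : List V → List V → Set) : List V → List V → Set where
  rewriteAt : ∀ x y {l r} → R l r → Rewrite R (x ++ l ++ y) (x ++ r ++ y)

rewrite-∷ : ∀ {V : Set} {R : List V → List V → Set} a {s s′} →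
            Star (Rewrite R) s s′ → Star (Rewrite R) (a ∷ s) (a ∷ s′)
rewrite-∷ a = Star.gmap (a ∷_) λ { (rewriteAt x y r) → rewriteAt (a ∷ x) y r }

rewrite-++ˡ : ∀ {V : Set} {R : List V → List V → Set} u {s s′} →
              Star (Rewrite R) s s′ → Star (Rewrite R) (u ++ s) (u ++ s′)
rewrite-++ˡ []      p = p
rewrite-++ˡ (a ∷ u) p = rewrite-∷ a (rewrite-++ˡ u p)

++-singleton : ∀ {A : Set} x {a : A} {l y c} → x ++ (a ∷ l) ++ y ≡ c ∷ [] →
               x ≡ [] × a ≡ c × l ≡ [] × y ≡ []
++-singleton [] {l = []} {y = []} refl = refl , refl , refl , refl
++-singleton (_ ∷ []) ()
++-singleton (_ ∷ _ ∷ _) ()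

module _ {N : Set} {t : ℕ} (listN : Listable N) where
  open Listable listN using (size; code; decode; decode-code)

  codeSym : N ⊎ Fin t → Sym size t
  codeSym = Sum.map₁ code

  decodeSym : Sym size t → N ⊎ Fin t
  decodeSym = Sum.map₁ decode

  decode-codeSym : ∀ x → decodeSym (codeSym x) ≡ x
  decode-codeSym (inj₁ a) = cong inj₁ (decode-code a)
  decode-codeSym (inj₂ a) = refl

  decode-codeSyms : ∀ w → map decodeSym (map codeSym w) ≡ w
  decode-codeSyms w = trans (sym (List.map-∘ w)) (trans (List.map-cong decode-codeSym w) (List.map-id w))

record ContextRule (N : Set) (t : ℕ) : Set where
  constructor contextRule
  field
    left     : List (N ⊎ Fin t)
    pivot    : N
    right    : List (N ⊎ Fin t)
    replaced : List (N ⊎ Fin t)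

  lhs rhs : List (N ⊎ Fin t)
  lhs = left ++ inj₁ pivot ∷ right
  rhs = left ++ replaced ++ right

module _ {N : Set} {t : ℕ} (listN : Listable N) where
  open ContextRule
  private
    ⟪_⟫ = map (codeSym {t = t} listN)

  codeRule : ContextRule N t → CSRule (Listable.size listN) t
  codeRule r = csrule ⟪ left r ⟫ (Listable.code listN (pivot r)) ⟪ right r ⟫ ⟪ replaced r ⟫

  csLhs-code : ∀ r → csLhs (codeRule r) ≡ ⟪ lhs r ⟫
  csLhs-code r = sym (List.map-++ _ (left r) _)

  csRhs-code : ∀ r → csRhs (codeRule r) ≡ ⟪ rhs r ⟫
  csRhs-code r = sym (trans (List.map-++ _ (left r) _) (cong (⟪ left r ⟫ ++_) (List.map-++ _ (replaced r) _)))

module ContextGrammar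
  {N : Set} {t : ℕ} (listN : Listable N) {Name : Set} (listName : Listable Name)
  (rule : Name → ContextRule N t) (S : N)
  (wf : ∀ i → ContextRule.replaced (rule i) ≢ [] ⊎
        (ContextRule.pivot (rule i) ≡ S × ContextRule.left (rule i) ≡ [] × ContextRule.right (rule i) ≡ [] ×
         ∀ j → inj₁ S ∉ ContextRule.rhs (rule j)))
  where
  open ContextRule
  open Listable listN using (size; code)
  private
    ⟪_⟫ = map (codeSym {t = t} listN)
    ⟦_⟧ = map (decodeSym {t = t} listN)

  data RuleOf : List (N ⊎ Fin t) → List (N ⊎ Fin t) → Set where
    ruleOf : ∀ i → RuleOf (lhs (rule i)) (rhs (rule i))

  csRules : List (CSRule size t)
  csRules = map (codeRule listN ∘ rule) (elems listName)

  all-csRules : {Q : CSRule size t → Set} → (∀ i → Q (codeRule listN (rule i))) → All Q csRules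
  all-csRules q = All.map⁺ (All.universal q (elems listName))

  grammar : CSGrammar size t
  grammar = record
    { P = csRules
    ; S = code S
    ; wf = all-csRules λ i → Sum.map
        (λ ne e → ne (trans (sym (decode-codeSyms listN (replaced (rule i)))) (cong ⟦_⟧ e)))
        (λ { (e₁ , e₂ , e₃ , S∉) → cong code e₁ , cong ⟪_⟫ e₂ , cong ⟪_⟫ e₃ ,
             all-csRules λ j S∈ → S∉ j (subst₂ _∈_ (decode-codeSym listN (inj₁ S))
               (decode-codeSyms listN (rhs (rule j)))
               (∈-map⁺ (decodeSym listN) (subst (inj₁ (code S) ∈_) (csRhs-code listN (rule j)) S∈))) })
        (wf i) }

  private
    map-context : ∀ {A B : Set} (f : A → B) x y {l} → map f (x ++ l ++ y) ≡ map f x ++ map f l ++ map f y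
    map-context f x y {l} = trans (List.map-++ f x _) (cong (map f x ++_) (List.map-++ f l y))

  encode-step : ∀ {s s′} → Rewrite RuleOf s s′ → Step grammar ⟪ s ⟫ ⟪ s′ ⟫
  encode-step (rewriteAt x y (ruleOf i)) =
    subst₂ (Step grammar)
      (trans (cong (λ l → ⟪ x ⟫ ++ l ++ ⟪ y ⟫) (csLhs-code listN (rule i))) (sym (map-context _ x y)))
      (trans (cong (λ l → ⟪ x ⟫ ++ l ++ ⟪ y ⟫) (csRhs-code listN (rule i))) (sym (map-context _ x y)))
      (step ⟪ x ⟫ ⟪ y ⟫ (codeRule listN (rule i)) (∈-map⁺ _ (complete listName i)))

  -- Every number decodes, even one that is no code, so a derivation is decoded step by step with no
  -- invariant on its words.
  decode-step : ∀ {s s′} → Step grammar s s′ → Rewrite RuleOf ⟦ s ⟧ ⟦ s′ ⟧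
  decode-step (step x y _ r∈) with ∈-map⁻ _ r∈
  ... | i , _ , refl =
    subst₂ (Rewrite RuleOf)
      (trans (cong (λ l → ⟦ x ⟧ ++ l ++ ⟦ y ⟧)
               (sym (trans (cong ⟦_⟧ (csLhs-code listN (rule i))) (decode-codeSyms listN _))))
             (sym (map-context _ x y)))
      (trans (cong (λ l → ⟦ x ⟧ ++ l ++ ⟦ y ⟧)
               (sym (trans (cong ⟦_⟧ (csRhs-code listN (rule i))) (decode-codeSyms listN _))))
             (sym (map-context _ x y)))
      (rewriteAt ⟦ x ⟧ ⟦ y ⟧ (ruleOf i))

  language : ∀ z → CSLang grammar z ⇔ Star (Rewrite RuleOf) (inj₁ S ∷ []) (map inj₂ z)
  language z = mk⇔
    (λ p → subst₂ (Star (Rewrite RuleOf)) (cong (_∷ []) (decode-codeSym listN (inj₁ S))) (sym (List.map-∘ z))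
             (Star.gmap ⟦_⟧ decode-step p))
    (λ p → subst (Star (Step grammar) _) (sym (List.map-∘ z)) (Star.gmap ⟪_⟫ encode-step p))

-- Grammars that rewrite one or two adjacent nonterminals

record PairGrammar (N : Set) (t : ℕ) : Set₁ where
  field
    nonterminals : Listable N
    Unary Binary : Set
    unaries      : Listable Unary
    binaries     : Listable Binary
    unFrom       : Unary → N
    unHead       : Unary → N ⊎ Fin t
    unTail       : Unary → List (N ⊎ Fin t)
    biFrom₁ biFrom₂ biTo₁ : Binary → N
    biTo₂        : Binary → N ⊎ Fin t

  -- The split into `unHead` and `unTail` makes right-hand sides nonempty by construction. Only the
  -- second symbol of a binary result may be a terminal: the machine delivers its output at the
  -- right end of the tape, and what stays to the left of it is still tape.
  data PairRule : List (N ⊎ Fin t) → List (N ⊎ Fin t) → Set where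
    unary  : ∀ u → PairRule (inj₁ (unFrom u) ∷ []) (unHead u ∷ unTail u)
    binary : ∀ b → PairRule (inj₁ (biFrom₁ b) ∷ inj₁ (biFrom₂ b) ∷ []) (inj₁ (biTo₁ b) ∷ biTo₂ b ∷ [])

-- A rule b : AB → CD is executed as AB → [1,b]B → [1,b][2,b] → C[2,b] → CD.
module PairToCS {N : Set} {t : ℕ} (G : PairGrammar N t) (S : N) (hasλ : Bool) where
  open PairGrammar G

  -- A fresh `start`, on no right-hand side, is what makes a rule for the empty word admissible.
  data Nonterminal : Set where
    start        : Nonterminal
    old          : N → Nonterminal
    first second : Binary → Nonterminal

  listable-Nonterminal : Listable Nonterminal
  listable-Nonterminal = listable-image
    (λ { (inj₁ tt) → start ; (inj₂ (inj₁ A)) → old A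
       ; (inj₂ (inj₂ (inj₁ b))) → first b ; (inj₂ (inj₂ (inj₂ b))) → second b })
    (λ { start → inj₁ tt , refl ; (old A) → inj₂ (inj₁ A) , refl
       ; (first b) → inj₂ (inj₂ (inj₁ b)) , refl ; (second b) → inj₂ (inj₂ (inj₂ b)) , refl })
    (listable-⊎ listable-⊤ (listable-⊎ nonterminals (listable-⊎ binaries binaries)))

  data Name : Set where
    init                      : Name
    empty                     : T hasλ → Name
    un                        : Unary → Name
    open₁ open₂ close₁ close₂ : Binary → Name

  listable-Name : Listable Name
  listable-Name = listable-image
    (λ { (inj₁ tt) → init ; (inj₂ (inj₁ e)) → empty e ; (inj₂ (inj₂ (inj₁ u))) → un u
       ; (inj₂ (inj₂ (inj₂ (b , true , true)))) → open₁ b ; (inj₂ (inj₂ (inj₂ (b , true , false)))) → open₂ b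
       ; (inj₂ (inj₂ (inj₂ (b , false , true)))) → close₁ b ; (inj₂ (inj₂ (inj₂ (b , false , false)))) → close₂ b })
    (λ { init → inj₁ tt , refl ; (empty e) → inj₂ (inj₁ e) , refl ; (un u) → inj₂ (inj₂ (inj₁ u)) , refl
       ; (open₁ b) → inj₂ (inj₂ (inj₂ (b , true , true))) , refl
       ; (open₂ b) → inj₂ (inj₂ (inj₂ (b , true , false))) , refl
       ; (close₁ b) → inj₂ (inj₂ (inj₂ (b , false , true))) , refl
       ; (close₂ b) → inj₂ (inj₂ (inj₂ (b , false , false))) , refl })
    (listable-⊎ listable-⊤ (listable-⊎ (listable-T hasλ) (listable-⊎ unaries
      (listable-× binaries (listable-× listable-Bool listable-Bool)))))

  oldSym : N ⊎ Fin t → Nonterminal ⊎ Fin t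
  oldSym = Sum.map₁ old

  rule : Name → ContextRule Nonterminal t
  rule init       = contextRule [] start [] (inj₁ (old S) ∷ [])
  rule (empty _)  = contextRule [] start [] []
  rule (un u)     = contextRule [] (old (unFrom u)) [] (map oldSym (unHead u ∷ unTail u))
  rule (open₁ b)  = contextRule [] (old (biFrom₁ b)) (inj₁ (old (biFrom₂ b)) ∷ []) (inj₁ (first b) ∷ [])
  rule (open₂ b)  = contextRule (inj₁ (first b) ∷ []) (old (biFrom₂ b)) [] (inj₁ (second b) ∷ [])
  rule (close₁ b) = contextRule [] (first b) (inj₁ (second b) ∷ []) (inj₁ (old (biTo₁ b)) ∷ [])
  rule (close₂ b) = contextRule (inj₁ (old (biTo₁ b)) ∷ []) (second b) [] (oldSym (biTo₂ b) ∷ [])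

  NotStart : Nonterminal ⊎ Fin t → Set
  NotStart x = x ≢ inj₁ start

  oldSym-NotStart : ∀ x → NotStart (oldSym x)
  oldSym-NotStart (inj₁ _) ()
  oldSym-NotStart (inj₂ _) ()

  rhs-NotStart : ∀ i → All NotStart (ContextRule.rhs (rule i))
  rhs-NotStart init       = (λ ()) ∷ []
  rhs-NotStart (empty _)  = []
  rhs-NotStart (un u)     =
    All.++⁺ (All.map⁺ (All.universal oldSym-NotStart (unHead u ∷ unTail u))) []
  rhs-NotStart (open₁ b)  = (λ ()) ∷ (λ ()) ∷ []
  rhs-NotStart (open₂ b)  = (λ ()) ∷ (λ ()) ∷ []
  rhs-NotStart (close₁ b) = (λ ()) ∷ (λ ()) ∷ []
  rhs-NotStart (close₂ b) = (λ ()) ∷ oldSym-NotStart (biTo₂ b) ∷ []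

  start∉rhs : ∀ j → inj₁ start ∉ ContextRule.rhs (rule j)
  start∉rhs j start∈ = All.lookup (rhs-NotStart j) start∈ refl

  nonErasing : ∀ i → ContextRule.replaced (rule i) ≢ [] ⊎
               (ContextRule.pivot (rule i) ≡ start × ContextRule.left (rule i) ≡ [] × ContextRule.right (rule i) ≡ [] ×
                ∀ j → inj₁ start ∉ ContextRule.rhs (rule j))
  nonErasing init       = inj₁ λ ()
  nonErasing (empty _)  = inj₂ (refl , refl , refl , start∉rhs)
  nonErasing (un _)     = inj₁ λ ()
  nonErasing (open₁ _)  = inj₁ λ ()
  nonErasing (open₂ _)  = inj₁ λ ()
  nonErasing (close₁ _) = inj₁ λ ()
  nonErasing (close₂ _) = inj₁ λ ()

  module CS = ContextGrammar listable-Nonterminal listable-Name rule start nonErasing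

  open Listable binaries using (_≟_)

  -- The symbol [2,b] always stands for D, while [1,b] stands for C or A
  -- according to whether it is followed by [2,b]; thus only the step
  -- [1,b]B → [1,b][2,b] changes the word that is represented.
  follower : List (Nonterminal ⊎ Fin t) → Maybe Binary
  follower (inj₁ (second b) ∷ _) = just b
  follower _                     = nothing

  meaning : Nonterminal ⊎ Fin t → Maybe Binary → N ⊎ Fin t
  meaning (inj₁ start)      _        = inj₁ S
  meaning (inj₁ (old A))    _        = inj₁ A
  meaning (inj₁ (first b))  nothing  = inj₁ (biFrom₁ b)
  meaning (inj₁ (first b))  (just c) with b ≟ c
  ... | yes _ = inj₁ (biTo₁ b)
  ... | no _  = inj₁ (biFrom₁ b)
  meaning (inj₁ (second b)) _        = biTo₂ b
  meaning (inj₂ a)          _        = inj₂ a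

  meanings : List (Nonterminal ⊎ Fin t) → List (N ⊎ Fin t)
  meanings []      = []
  meanings (x ∷ s) = meaning x (follower s) ∷ meanings s

  meaning-fired : ∀ b → meaning (inj₁ (first b)) (just b) ≡ inj₁ (biTo₁ b)
  meaning-fired b with b ≟ b
  ... | yes _ = refl
  ... | no ¬p = ⊥-elim (¬p refl)

  meaning-oldSym : ∀ x m → meaning (oldSym x) m ≡ x
  meaning-oldSym (inj₁ _) _ = refl
  meaning-oldSym (inj₂ _) _ = refl

  meanings-old : ∀ w y → meanings (map oldSym w ++ y) ≡ w ++ meanings y
  meanings-old []      y = refl
  meanings-old (x ∷ w) y = cong₂ _∷_ (meaning-oldSym x _) (meanings-old w y)

  follower-oldSym : ∀ x s → follower (oldSym x ∷ s) ≡ nothing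
  follower-oldSym (inj₁ _) _ = refl
  follower-oldSym (inj₂ _) _ = refl

  infix 4 _⇒_ _⇒′_
  _⇒_ = Star (Rewrite PairRule)
  _⇒′_ = Star (Rewrite CS.RuleOf)

  ≡→⇒ : ∀ {s s′} → s ≡ s′ → s ⇒ s′
  ≡→⇒ refl = ε

  meanings-context : ∀ x {w w′} → follower w ≡ follower w′ → meanings w ⇒ meanings w′ →
                     meanings (x ++ w) ⇒ meanings (x ++ w′)
  meanings-context []      _ p = p
  meanings-context (a ∷ x) e p =
    subst (λ m → _ ⇒ meaning a m ∷ _) (follower-context x e) (rewrite-∷ _ (meanings-context x e p))
    where
    follower-context : ∀ x {w w′} → follower w ≡ follower w′ → follower (x ++ w) ≡ follower (x ++ w′)
    follower-context []                    e = e
    follower-context (inj₁ start ∷ _)      _ = refl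
    follower-context (inj₁ (old _) ∷ _)    _ = refl
    follower-context (inj₁ (first _) ∷ _)  _ = refl
    follower-context (inj₁ (second _) ∷ _) _ = refl
    follower-context (inj₂ _ ∷ _)          _ = refl

  -- The meaning of a symbol depends on its right neighbour, so a replacement could alter the
  -- meaning of the symbol before it. The equality of followers excludes this: neither side of a
  -- rule begins with a `second`, and where a `second` is created or removed, its left neighbour
  -- belongs to the context of the rule.
  rule-sound : ∀ i y → All NotStart (ContextRule.lhs (rule i)) →
               let open ContextRule (rule i) in
               follower (lhs ++ y) ≡ follower (rhs ++ y) × (meanings (lhs ++ y) ⇒ meanings (rhs ++ y))
  rule-sound init       y (ns ∷ _) = ⊥-elim (ns refl)
  rule-sound (empty _)  y (ns ∷ _) = ⊥-elim (ns refl)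
  rule-sound (un u)     y _ = sym (follower-oldSym (unHead u) _) ,
    subst (inj₁ (unFrom u) ∷ meanings y ⇒_)
      (sym (trans (cong meanings (List.++-assoc (map oldSym (unHead u ∷ unTail u)) [] y))
                  (meanings-old (unHead u ∷ unTail u) y)))
      (rewriteAt [] (meanings y) (unary u) ◅ ε)
  rule-sound (open₁ b)  y _ = refl , ε
  rule-sound (open₂ b)  y _ = refl ,
    subst (λ x → inj₁ (biFrom₁ b) ∷ inj₁ (biFrom₂ b) ∷ meanings y ⇒ x ∷ biTo₂ b ∷ meanings y)
      (sym (meaning-fired b)) (rewriteAt [] (meanings y) (binary b) ◅ ε)
  rule-sound (close₁ b) y _ = refl , ≡→⇒ (cong (_∷ biTo₂ b ∷ meanings y) (meaning-fired b))
  rule-sound (close₂ b) y _ = refl , ≡→⇒ (cong (λ x → inj₁ (biTo₁ b) ∷ x ∷ meanings y) (sym (meaning-oldSym (biTo₂ b) _)))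

  step-sound : ∀ {s s′} → All NotStart s → Rewrite CS.RuleOf s s′ → All NotStart s′ × (meanings s ⇒ meanings s′)
  step-sound ns (rewriteAt x y (CS.ruleOf i)) with All.++⁻ x ns
  ... | nx , nly with All.++⁻ (ContextRule.lhs (rule i)) nly
  ... | nl , ny with rule-sound i y nl
  ... | e , p = All.++⁺ nx (All.++⁺ (rhs-NotStart i) ny) , meanings-context x e p

  steps-sound : ∀ {s s′} → All NotStart s → s ⇒′ s′ → meanings s ⇒ meanings s′
  steps-sound ns ε = ε
  steps-sound ns (p ◅ ps) with step-sound ns p
  ... | ns′ , q = q ◅◅ steps-sound ns′ ps

  meanings-terminals : ∀ z → meanings (map inj₂ z) ≡ map inj₂ z
  meanings-terminals []      = refl
  meanings-terminals (_ ∷ z) = cong (_ ∷_) (meanings-terminals z)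

  stuck : ∀ {s} → [] ⇒′ s → s ≡ []
  stuck ε = refl
  stuck (p ◅ _) = ⊥-elim (no-step p refl)
    where
    no-step : ∀ {s s′} → Rewrite CS.RuleOf s s′ → s ≢ []
    no-step (rewriteAt (_ ∷ _) _ _) ()
    no-step (rewriteAt [] _ (CS.ruleOf init)) ()
    no-step (rewriteAt [] _ (CS.ruleOf (empty _))) ()
    no-step (rewriteAt [] _ (CS.ruleOf (un _))) ()
    no-step (rewriteAt [] _ (CS.ruleOf (open₁ _))) ()
    no-step (rewriteAt [] _ (CS.ruleOf (open₂ _))) ()
    no-step (rewriteAt [] _ (CS.ruleOf (close₁ _))) ()
    no-step (rewriteAt [] _ (CS.ruleOf (close₂ _))) ()

  start-step : ∀ {s s′} → Rewrite CS.RuleOf s s′ → s ≡ inj₁ start ∷ [] →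
               s′ ≡ inj₁ (old S) ∷ [] ⊎ (T hasλ × s′ ≡ [])
  start-step (rewriteAt x y (CS.ruleOf init)) e with ++-singleton x {l = []} e
  ... | refl , refl , refl , refl = inj₁ refl
  start-step (rewriteAt x y (CS.ruleOf (empty h))) e with ++-singleton x {l = []} e
  ... | refl , refl , refl , refl = inj₂ (h , refl)
  start-step (rewriteAt x y (CS.ruleOf (un _))) e with ++-singleton x {l = []} e
  ... | _ , () , _
  start-step (rewriteAt x y (CS.ruleOf (open₁ _))) e with ++-singleton x {l = _ ∷ []} e
  ... | _ , () , _
  start-step (rewriteAt x y (CS.ruleOf (open₂ _))) e with ++-singleton x {l = _ ∷ []} e
  ... | _ , () , _
  start-step (rewriteAt x y (CS.ruleOf (close₁ _))) e with ++-singleton x {l = _ ∷ []} e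
  ... | _ , () , _
  start-step (rewriteAt x y (CS.ruleOf (close₂ _))) e with ++-singleton x {l = _ ∷ []} e
  ... | _ , () , _

  sound : ∀ z → inj₁ start ∷ [] ⇒′ map inj₂ z → (T hasλ × z ≡ []) ⊎ (inj₁ S ∷ [] ⇒ map inj₂ z)
  sound z p = go p refl
    where
    go : ∀ {s} → s ⇒′ map inj₂ z → s ≡ inj₁ start ∷ [] → (T hasλ × z ≡ []) ⊎ (inj₁ S ∷ [] ⇒ map inj₂ z)
    go ε e = ⊥-elim (terminals-≢start z e)
      where
      terminals-≢start : ∀ z → map inj₂ z ≢ inj₁ start ∷ []
      terminals-≢start [] ()
      terminals-≢start (_ ∷ _) ()
    go (q ◅ qs) e with start-step q e
    ... | inj₁ refl = inj₂ (subst (_ ⇒_) (meanings-terminals z) (steps-sound ((λ ()) ∷ []) qs))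
    ... | inj₂ (h , refl) = inj₁ (h , map-[] inj₂ z (stuck qs))

  private
    ⟪_⟫ = map oldSym

  context : ∀ x y {l r} → l ⇒′ r → x ++ l ++ y ⇒′ x ++ r ++ y
  context x y p = rewrite-++ˡ x (Star.gmap (_++ y) (λ { (rewriteAt u v {l} {r} ρ) →
    subst₂ (Rewrite CS.RuleOf) (sym (reassoc u l v)) (sym (reassoc u r v)) (rewriteAt u (v ++ y) ρ) }) p)
    where
    reassoc : ∀ u l v → (u ++ l ++ v) ++ y ≡ u ++ l ++ v ++ y
    reassoc u l v = trans (List.++-assoc u (l ++ v) y) (cong (u ++_) (List.++-assoc l v y))

  complete-rule : ∀ {l r} → PairRule l r → ⟪ l ⟫ ⇒′ ⟪ r ⟫
  complete-rule (unary u) =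
    subst (inj₁ (old (unFrom u)) ∷ [] ⇒′_) (trans (List.++-identityʳ _) (List.++-identityʳ ⟪ unHead u ∷ unTail u ⟫))
      (rewriteAt [] [] (CS.ruleOf (un u)) ◅ ε)
  complete-rule (binary b) =
    rewriteAt [] [] (CS.ruleOf (open₁ b)) ◅ rewriteAt [] [] (CS.ruleOf (open₂ b)) ◅
    rewriteAt [] [] (CS.ruleOf (close₁ b)) ◅ rewriteAt [] [] (CS.ruleOf (close₂ b)) ◅ ε

  complete-step : ∀ {s s′} → Rewrite PairRule s s′ → ⟪ s ⟫ ⇒′ ⟪ s′ ⟫
  complete-step (rewriteAt x y {l} {r} ρ) =
    subst₂ _⇒′_ (sym (map-context l)) (sym (map-context r)) (context ⟪ x ⟫ ⟪ y ⟫ (complete-rule ρ))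
    where
    map-context : ∀ l → ⟪ x ++ l ++ y ⟫ ≡ ⟪ x ⟫ ++ ⟪ l ⟫ ++ ⟪ y ⟫
    map-context l = trans (List.map-++ _ x _) (cong (⟪ x ⟫ ++_) (List.map-++ _ l y))

  complete-steps : ∀ {s s′} → s ⇒ s′ → ⟪ s ⟫ ⇒′ ⟪ s′ ⟫
  complete-steps ε        = ε
  complete-steps (p ◅ ps) = complete-step p ◅◅ complete-steps ps

  language : ∀ z → CSLang CS.grammar z ⇔ ((T hasλ × z ≡ []) ⊎ (inj₁ S ∷ [] ⇒ map inj₂ z))
  language z = mk⇔
    (λ p → sound z (Equivalence.to (CS.language z) p))
    (λ { (inj₁ (h , refl)) → Equivalence.from (CS.language []) (rewriteAt [] [] (CS.ruleOf (empty h)) ◅ ε)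
       ; (inj₂ p) → Equivalence.from (CS.language z)
           (rewriteAt [] [] (CS.ruleOf init) ◅ subst (_ ⇒′_) (sym (List.map-∘ z)) (complete-steps p)) })

-- One-head machines

-- A one-head machine on a tape that may grow but never shrinks; the rules in
-- Local l r apply when the head is at the left end (l) and at the right end (r).
record Machine (t : ℕ) : Set₁ where
  field
    State Cell            : Set
    states                : Listable State
    cells                 : Listable Cell
    Local                 : Bool → Bool → Set
    locals                : ∀ l r → Listable (Local l r)
    localFrom localTo     : ∀ {l r} → Local l r → State
    localCell localHead   : ∀ {l r} → Local l r → Cell
    localTail             : ∀ {l r} → Local l r → List Cell
    LeftMove RightMove    : Set
    leftMoves             : Listable LeftMove
    rightMoves            : Listable RightMove
    leftFrom leftTo       : LeftMove → State
    rightFrom rightTo     : RightMove → State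
    Pop                   : Set
    pops                  : Listable Pop
    popFrom popTo         : Pop → State
    popCell               : Pop → Cell
    popOutput             : Pop → Fin t

  -- In run u κ c v z the tape is reverse u, the scanned cell c, and v; the
  -- word z has already been output to the right of the tape.
  data Config : Set where
    run  : List Cell → State → Cell → List Cell → List (Fin t) → Config
    done : List (Fin t) → Config

  infix 4 _⊢_
  data _⊢_ : Config → Config → Set where
    local  : ∀ {l r u v z} (i : Local l r) → null u ≡ l → null v ≡ r →
             run u (localFrom i) (localCell i) v z ⊢ run u (localTo i) (localHead i) (localTail i ++ v) z
    left   : ∀ {x u c v z} i → run (x ∷ u) (leftFrom i) c v z ⊢ run u (leftTo i) x (c ∷ v) z
    right  : ∀ {u c x v z} i → run u (rightFrom i) c (x ∷ v) z ⊢ run (c ∷ u) (rightTo i) x v z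
    pop    : ∀ {x u z} i → run (x ∷ u) (popFrom i) (popCell i) [] z ⊢ run u (popTo i) x [] (popOutput i ∷ z)
    finish : ∀ {z} i → run [] (popFrom i) (popCell i) [] z ⊢ done (popOutput i ∷ z)

-- Machines as pair grammars

module MachineToPair {t : ℕ} (M : Machine t) where
  open Machine M

  -- Head and end marks are stored inside the tape symbols. As separate symbols they would have to
  -- be erased in the end, which no non-erasing grammar can do.
  data Nonterminal : Set where
    cell : (head : Maybe State) (isLeftEnd isRightEnd : Bool) → Cell → Nonterminal

  listable-Nonterminal : Listable Nonterminal
  listable-Nonterminal = listable-image
    (λ { (κ , l , r , c) → cell κ l r c }) (λ { (cell κ l r c) → (κ , l , r , c) , refl })
    (listable-× (listable-Maybe states) (listable-× listable-Bool (listable-× listable-Bool cells)))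

  Symbol : Set
  Symbol = Nonterminal ⊎ Fin t

  idle : Bool → Bool → Cell → Symbol
  idle l r c = inj₁ (cell nothing l r c)

  scanned : State → Bool → Bool → Cell → Symbol
  scanned κ l r c = inj₁ (cell (just κ) l r c)

  encodeLeft : List Cell → List Symbol
  encodeLeft []      = []
  encodeLeft (x ∷ u) = encodeLeft u ++ idle (null u) false x ∷ []

  -- The flag tells whether the cells reach the right end of the tape; it is false for cells
  -- inserted before others.
  encodeRight : Bool → List Cell → List Symbol
  encodeRight r []      = []
  encodeRight r (x ∷ v) = idle false (r ∧ null v) x ∷ encodeRight r v

  encode : Config → List Symbol
  encode (run u κ c v z) = encodeLeft u ++ scanned κ (null u) (null v) c ∷ encodeRight true v ++ map inj₂ z
  encode (done z)        = map inj₂ z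

  Bi : Set
  Bi = (LeftMove × Bool × Bool × Cell × Cell) ⊎ (RightMove × Bool × Bool × Cell × Cell) ⊎ (Pop × Bool × Cell)

  Un : Set
  Un = (Σ (Bool × Bool) λ { (l , r) → Local l r }) ⊎ Pop

  grammar : PairGrammar Nonterminal t
  grammar = record
    { nonterminals = listable-Nonterminal
    ; Unary = Un
    ; Binary = Bi
    ; unaries = listable-⊎
        (listable-Σ (listable-× listable-Bool listable-Bool) (λ { (l , r) → locals l r })) pops
    ; binaries = listable-⊎
        (listable-× leftMoves (listable-× listable-Bool (listable-× listable-Bool (listable-× cells cells))))
        (listable-⊎
          (listable-× rightMoves (listable-× listable-Bool (listable-× listable-Bool (listable-× cells cells))))
          (listable-× pops (listable-× listable-Bool cells)))
    ; unFrom = λ { (inj₁ ((l , r) , i)) → cell (just (localFrom i)) l r (localCell i)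
                 ; (inj₂ i) → cell (just (popFrom i)) true true (popCell i) }
    ; unHead = λ { (inj₁ ((l , r) , i)) → scanned (localTo i) l (r ∧ null (localTail i)) (localHead i)
                 ; (inj₂ i) → inj₂ (popOutput i) }
    ; unTail = λ { (inj₁ ((l , r) , i)) → encodeRight r (localTail i)
                 ; (inj₂ i) → [] }
    -- Of two adjacent cells the first is not the right end and the second is not the left end. The
    -- outer flags `l` and `r` are arbitrary and are copied, except that a pop makes the first cell
    -- the new right end.
    ; biFrom₁ = λ { (inj₁ (i , l , r , x , c)) → cell nothing l false x
                  ; (inj₂ (inj₁ (i , l , r , x , c))) → cell (just (rightFrom i)) l false c
                  ; (inj₂ (inj₂ (i , l , x))) → cell nothing l false x }
    ; biFrom₂ = λ { (inj₁ (i , l , r , x , c)) → cell (just (leftFrom i)) false r c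
                  ; (inj₂ (inj₁ (i , l , r , x , c))) → cell nothing false r x
                  ; (inj₂ (inj₂ (i , l , x))) → cell (just (popFrom i)) false true (popCell i) }
    ; biTo₁ = λ { (inj₁ (i , l , r , x , c)) → cell (just (leftTo i)) l false x
                ; (inj₂ (inj₁ (i , l , r , x , c))) → cell nothing l false c
                ; (inj₂ (inj₂ (i , l , x))) → cell (just (popTo i)) l true x }
    ; biTo₂ = λ { (inj₁ (i , l , r , x , c)) → idle false r c
                ; (inj₂ (inj₁ (i , l , r , x , c))) → scanned (rightTo i) false r x
                ; (inj₂ (inj₂ (i , l , x))) → inj₂ (popOutput i) } }

  open PairGrammar grammar using (PairRule; unary; binary)

  private
    null-++ : ∀ (xs : List Cell) v → null v ∧ null xs ≡ null (xs ++ v)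
    null-++ []       []      = refl
    null-++ []       (_ ∷ _) = refl
    null-++ (_ ∷ _)  []      = refl
    null-++ (_ ∷ _)  (_ ∷ _) = refl

    encodeRight-++ : ∀ xs v → encodeRight (null v) xs ++ encodeRight true v ≡ encodeRight true (xs ++ v)
    encodeRight-++ []       v = refl
    encodeRight-++ (x ∷ xs) v = cong₂ _∷_ (cong (λ r → idle false r x) (null-++ xs v)) (encodeRight-++ xs v)

    encode-local : ∀ {l r} (i : Local l r) u v z → null u ≡ l → null v ≡ r →
      encodeLeft u ++
        (scanned (localTo i) l (r ∧ null (localTail i)) (localHead i) ∷ encodeRight r (localTail i)) ++
        encodeRight true v ++ map inj₂ z
      ≡ encode (run u (localTo i) (localHead i) (localTail i ++ v) z)
    encode-local i u v z refl refl = cong (encodeLeft u ++_) (cong₂ _∷_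
      (cong (λ r → scanned (localTo i) (null u) r (localHead i)) (null-++ (localTail i) v))
      (trans (sym (List.++-assoc (encodeRight (null v) (localTail i)) _ _))
             (cong (_++ map inj₂ z) (encodeRight-++ (localTail i) v))))

  infix 4 _⇒_
  _⇒_ = Rewrite PairRule

  complete-step : ∀ {χ χ′} → χ ⊢ χ′ → encode χ ⇒ encode χ′
  complete-step (local {u = u} {v} {z} i refl refl) =
    subst (encode (run u (localFrom i) (localCell i) v z) ⇒_) (encode-local i u v z refl refl)
      (rewriteAt (encodeLeft u) _ (unary (inj₁ (_ , i))))
  complete-step (left {x} {u} {c} {v} {z} i) =
    subst (_⇒ encode (run u (leftTo i) x (c ∷ v) z)) (sym (List.++-assoc (encodeLeft u) _ _))
      (rewriteAt (encodeLeft u) _ (binary (inj₁ (i , null u , null v , x , c))))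
  complete-step (right {u} {c} {x} {v} {z} i) =
    subst (encode (run u (rightFrom i) c (x ∷ v) z) ⇒_) (sym (List.++-assoc (encodeLeft u) _ _))
      (rewriteAt (encodeLeft u) _ (binary (inj₂ (inj₁ (i , null u , null v , x , c)))))
  complete-step (pop {x} {u} {z} i) =
    subst (_⇒ encode (run u (popTo i) x [] (popOutput i ∷ z))) (sym (List.++-assoc (encodeLeft u) _ _))
      (rewriteAt (encodeLeft u) _ (binary (inj₂ (inj₂ (i , null u , x)))))
  complete-step (finish i) = rewriteAt [] _ (unary (inj₂ i))

  IsHead : Symbol → Set
  IsHead (inj₁ (cell (just _) _ _ _)) = ⊤
  IsHead _                            = ⊥

  NonHead : Symbol → Set
  NonHead x = ¬ IsHead x

  encodeLeft-NonHead : ∀ u → All NonHead (encodeLeft u)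
  encodeLeft-NonHead []      = []
  encodeLeft-NonHead (x ∷ u) = All.++⁺ (encodeLeft-NonHead u) ((λ ()) ∷ [])

  encodeRight-NonHead : ∀ r v → All NonHead (encodeRight r v)
  encodeRight-NonHead r []      = []
  encodeRight-NonHead r (x ∷ v) = (λ ()) ∷ encodeRight-NonHead r v

  terminals-NonHead : ∀ z → All NonHead (map inj₂ z)
  terminals-NonHead z = All.map⁺ (All.universal (λ _ ()) z)

  no-head : ∀ x {h y s} → IsHead h → All NonHead s → x ++ h ∷ y ≢ s
  no-head x ih ns refl = All.head (All.++⁻ʳ x ns) ih

  unique-head : ∀ x {h y} u {h′ v} → IsHead h → All NonHead u → All NonHead v →
                x ++ h ∷ y ≡ u ++ h′ ∷ v → x ≡ u × h ≡ h′ × y ≡ v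
  unique-head []      []      ih nu nv refl = refl , refl , refl
  unique-head []      (b ∷ u) ih (nb ∷ _) nv refl = ⊥-elim (nb ih)
  unique-head (a ∷ x) []      ih nu nv refl = ⊥-elim (no-head x ih nv refl)
  unique-head (a ∷ x) (b ∷ u) ih (_ ∷ nu) nv e with List.∷-injective e
  ... | refl , e′ with unique-head x u ih nu nv e′
  ... | refl , e₁ , e₂ = refl , e₁ , e₂

  scanned-injective : ∀ {κ l r c κ′ l′ r′ c′} → scanned κ l r c ≡ scanned κ′ l′ r′ c′ →
                      κ ≡ κ′ × l ≡ l′ × r ≡ r′ × c ≡ c′
  scanned-injective refl = refl , refl , refl , refl

  idle-injective : ∀ {l r c l′ r′ c′} → idle l r c ≡ idle l′ r′ c′ → l ≡ l′ × r ≡ r′ × c ≡ c′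
  idle-injective refl = refl , refl , refl

  -- An encoded configuration has at most one head symbol and every left-hand side contains one. The
  -- place of application thus determines the whole configuration, and each grammar step is a
  -- machine step.
  locate : ∀ χ x {κ l r c y} → x ++ scanned κ l r c ∷ y ≡ encode χ →
           ∃ λ u → ∃ λ v → ∃ λ z → χ ≡ run u κ c v z × null u ≡ l × null v ≡ r ×
           x ≡ encodeLeft u × y ≡ encodeRight true v ++ map inj₂ z
  locate (done z) x e = ⊥-elim (no-head x tt (terminals-NonHead z) e)
  locate (run u κ c v z) x e
    with unique-head x (encodeLeft u) tt (encodeLeft-NonHead u)
           (All.++⁺ (encodeRight-NonHead true v) (terminals-NonHead z)) e
  ... | e₁ , e₂ , e₃ with scanned-injective e₂
  ... | refl , e₄ , e₅ , refl = u , v , z , refl , sym e₄ , sym e₅ , e₁ , e₃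

  encodeLeft-∷ʳ : ∀ x u {a} → x ++ a ∷ [] ≡ encodeLeft u →
                  ∃ λ b → ∃ λ u′ → u ≡ b ∷ u′ × x ≡ encodeLeft u′ × a ≡ idle (null u′) false b
  encodeLeft-∷ʳ []      [] ()
  encodeLeft-∷ʳ (_ ∷ _) [] ()
  encodeLeft-∷ʳ x (b ∷ u) e with List.∷ʳ-injective x (encodeLeft u) e
  ... | e₁ , e₂ = b , u , refl , e₁ , e₂

  sound-step : ∀ χ {s s′} → s ≡ encode χ → s ⇒ s′ → ∃ λ χ′ → χ ⊢ χ′ × s′ ≡ encode χ′
  sound-step χ e (rewriteAt x y (unary (inj₁ (_ , i)))) with locate χ x e
  ... | u , v , z , refl , e₁ , e₂ , refl , refl = _ , local i e₁ e₂ , encode-local i u v z e₁ e₂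
  sound-step χ e (rewriteAt x y (unary (inj₂ i))) with locate χ x e
  ... | [] , [] , z , refl , _ , _ , refl , refl = _ , finish i , refl
  -- For left moves and pops the head is the second symbol of the left-hand side, so the idle cell
  -- before it is moved into the prefix, where `encodeLeft-∷ʳ` recovers it.
  sound-step χ e (rewriteAt x y (binary (inj₁ (i , l , r , a , c))))
    with locate χ (x ++ idle l false a ∷ []) (trans (List.++-assoc x _ _) e)
  ... | u , v , z , refl , _ , refl , e₁ , refl with encodeLeft-∷ʳ x u e₁
  ... | _ , u′ , refl , refl , e₂ with idle-injective e₂
  ... | refl , _ , refl = _ , left i , refl
  sound-step χ e (rewriteAt x y (binary (inj₂ (inj₁ (i , l , r , a , c))))) with locate χ x e
  ... | u , [] , []    , _ , _ , _ , _ , ()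
  ... | u , [] , _ ∷ _ , _ , _ , _ , _ , ()
  ... | u , b ∷ v , z , refl , refl , _ , refl , refl = _ , right i , sym (List.++-assoc (encodeLeft u) _ _)
  sound-step χ e (rewriteAt x y (binary (inj₂ (inj₂ (i , l , a)))))
    with locate χ (x ++ idle l false a ∷ []) (trans (List.++-assoc x _ _) e)
  ... | u , [] , z , refl , _ , _ , e₁ , refl with encodeLeft-∷ʳ x u e₁
  ... | _ , u′ , refl , refl , e₂ with idle-injective e₂
  ... | refl , _ , refl = _ , pop i , refl

  sound-steps : ∀ χ {s z} → s ≡ encode χ → Star _⇒_ s (map inj₂ z) → Star _⊢_ χ (done z)
  sound-steps (done z) e ε = subst (λ z′ → Star _⊢_ (done z) (done z′)) (sym (List.map-injective inj₂-injective e)) ε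
  sound-steps (run u κ c v _) {z = z} e ε =
    ⊥-elim (no-head (encodeLeft u) tt (terminals-NonHead z) (sym e))
  sound-steps χ e (p ◅ ps) with sound-step χ e p
  ... | χ′ , q , e′ = q ◅ sound-steps χ′ e′ ps

  initial : State → Cell → Nonterminal
  initial κ c = cell (just κ) true true c

  language : ∀ κ c z → Star _⊢_ (run [] κ c [] []) (done z) ⇔ Star _⇒_ (inj₁ (initial κ c) ∷ []) (map inj₂ z)
  language κ c z = mk⇔ (Star.gmap encode complete-step) (sound-steps (run [] κ c [] []) refl)

-- Derivation trees level by level

-- A horizontal cut through a derivation tree: the nodes of one level, together
-- with the terminals (dead) whose leaves lie on earlier levels.
data Cell (n t : ℕ) : Set where
  live : Sym n t → Cell n t
  dead : Fin t → Cell n t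

liveSyms : ∀ {n t} → List (Cell n t) → List (Sym n t)
liveSyms []           = []
liveSyms (live x ∷ w) = x ∷ liveSyms w
liveSyms (dead a ∷ w) = liveSyms w

data Terms {n t : ℕ} : List (Cell n t) → List (Fin t) → Set where
  []     : Terms [] []
  live∷_ : ∀ {a w z} → Terms w z → Terms (live (inj₂ a) ∷ w) (a ∷ z)
  dead∷_ : ∀ {a w z} → Terms w z → Terms (dead a ∷ w) (a ∷ z)

-- `rule` demands a nonempty right-hand side, so a cut never becomes shorter; the erasing rule is
-- treated apart in `Derives`.
data Expand {n t : ℕ} (P : List (Rule n t)) : List (Cell n t) → List (Cell n t) → Set where
  []   : Expand P [] []
  rule : ∀ {A x xs w w′} → (A , x ∷ xs) ∈ P → Expand P w w′ →
         Expand P (live (inj₁ A) ∷ w) (map live (x ∷ xs) ++ w′)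
  age  : ∀ {a w w′} → Expand P w w′ → Expand P (live (inj₂ a) ∷ w) (dead a ∷ w′)
  keep : ∀ {a w w′} → Expand P w w′ → Expand P (dead a ∷ w) (dead a ∷ w′)

module Levels {n t k : ℕ} (G : TCGrammarSLT n t k) where
  open TCGrammarSLT G

  -- The control concerns the cut that is left behind, so the last cut of a sequence is
  -- unrestricted, like the last level of a tree.
  LevelStep : List (Cell n t) → List (Cell n t) → Set
  LevelStep w w′ = Expand P w w′ × InSLT R (liveSyms w)

  -- The trees hanging from a cut, with a bare terminal for each leaf already passed. Induction on
  -- trees is replaced by induction on forests because a step expands all nodes of a level together.
  Forest : Set
  Forest = List (Tree n t ⊎ Fin t)

  cut : Forest → List (Cell n t)
  cut []           = []
  cut (inj₁ x ∷ f) = live (label x) ∷ cut f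
  cut (inj₂ a ∷ f) = dead a ∷ cut f

  forestYield : Forest → List (Fin t)
  forestYield []           = []
  forestYield (inj₁ x ∷ f) = yield x ++ forestYield f
  forestYield (inj₂ a ∷ f) = a ∷ forestYield f

  forestHeight : Forest → ℕ
  forestHeight []           = 0
  forestHeight (inj₁ x ∷ f) = height x ⊔ forestHeight f
  forestHeight (inj₂ a ∷ f) = forestHeight f

  forestLevel : ℕ → Forest → List (Sym n t)
  forestLevel j []           = []
  forestLevel j (inj₁ x ∷ f) = level j x ++ forestLevel j f
  forestLevel j (inj₂ a ∷ f) = forestLevel j f

  ForestValid : Forest → Set
  ForestValid []           = ⊤
  ForestValid (inj₁ x ∷ f) = Valid P x × ForestValid f
  ForestValid (inj₂ a ∷ f) = ForestValid f

  level-zero : ∀ f → forestLevel 0 f ≡ liveSyms (cut f)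
  level-zero []           = refl
  level-zero (inj₁ x ∷ f) = cong (label x ∷_) (level-zero f)
  level-zero (inj₂ a ∷ f) = level-zero f

  infixr 5 _⧺_
  _⧺_ : List (Tree n t) → Forest → Forest
  ts ⧺ f = map inj₁ ts ++ f

  cut-⧺ : ∀ ts f → cut (ts ⧺ f) ≡ map live (labels ts) ++ cut f
  cut-⧺ []       f = refl
  cut-⧺ (_ ∷ ts) f = cong (_ ∷_) (cut-⧺ ts f)

  yield-⧺ : ∀ ts f → forestYield (ts ⧺ f) ≡ yields ts ++ forestYield f
  yield-⧺ []       f = refl
  yield-⧺ (x ∷ ts) f = trans (cong (yield x ++_) (yield-⧺ ts f)) (sym (List.++-assoc (yield x) _ _))

  height-⧺ : ∀ ts f → forestHeight (ts ⧺ f) ≡ heights ts ⊔ forestHeight f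
  height-⧺ []       f = refl
  height-⧺ (x ∷ ts) f =
    trans (cong (height x ⊔_) (height-⧺ ts f)) (sym (ℕ.⊔-assoc (height x) _ _))

  level-⧺ : ∀ j ts f → forestLevel j (ts ⧺ f) ≡ levels j ts ++ forestLevel j f
  level-⧺ j []       f = refl
  level-⧺ j (x ∷ ts) f = trans (cong (level j x ++_) (level-⧺ j ts f)) (sym (List.++-assoc (level j x) _ _))

  valid-⧺ : ∀ ts f → ForestValid (ts ⧺ f) → ValidAll P ts × ForestValid f
  valid-⧺ []       f v       = tt , v
  valid-⧺ (x ∷ ts) f (v , w) with valid-⧺ ts f w
  ... | vs , u = (v , vs) , u

  valid-⧺⁺ : ∀ ts f → ValidAll P ts → ForestValid f → ForestValid (ts ⧺ f)
  valid-⧺⁺ []       f _        u = u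
  valid-⧺⁺ (x ∷ ts) f (v , vs) u = v , valid-⧺⁺ ts f vs u

  -- From sequences of cuts to trees

  split : ∀ xs {w} f → cut f ≡ map live xs ++ w →
          ∃ λ ts → ∃ λ g → f ≡ ts ⧺ g × labels ts ≡ xs × cut g ≡ w
  split []       f            e = [] , f , refl , refl , e
  split (x ∷ xs) (inj₁ y ∷ f) e with List.∷-injective e
  ... | refl , e′ with split xs f e′
  ... | ts , g , refl , refl , e″ = y ∷ ts , g , refl , refl , e″

  -- The height is only bounded from above: a step in which all cells are terminals adds none. The
  -- bound suffices, since control is asked for levels below the height.
  record Lifted (w : List (Cell n t)) (f : Forest) : Set where
    constructor lifted
    field
      forest     : Forest
      cut≡       : cut forest ≡ w
      valid      : ForestValid forest
      yield≡     : forestYield forest ≡ forestYield f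
      height≤    : forestHeight forest ≤ suc (forestHeight f)
      level≡     : ∀ j → forestLevel (suc j) forest ≡ forestLevel j f

  lift : ∀ {w w′} → Expand P w w′ → ∀ f → cut f ≡ w′ → ForestValid f → Lifted w f
  lift [] (inj₁ _ ∷ _) ()
  lift [] (inj₂ _ ∷ _) ()
  lift [] [] refl v = lifted [] refl tt refl z≤n λ _ → refl
  lift (rule {A} {x} {xs} r∈ p) f e v with split (x ∷ xs) f e
  ... | ts , g , refl , l≡xs , e′ with valid-⧺ ts g v
  ... | vts , vg with lift p g e′ vg
  ... | lifted h refl vh y≡ h≤ l≡ = lifted (inj₁ (node A ts) ∷ h) refl
    ((subst (λ u → (A , u) ∈ P) (sym l≡xs) r∈ , vts) , vh)
    (trans (cong (yields ts ++_) y≡) (sym (yield-⧺ ts g)))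
    (subst (λ m → suc (heights ts) ⊔ forestHeight h ≤ suc m) (sym (height-⧺ ts g)) (ℕ.⊔-monoʳ-≤ (suc (heights ts)) h≤))
    (λ j → trans (cong (levels j ts ++_) (l≡ j)) (sym (level-⧺ j ts g)))
  lift (age {a} p) (inj₂ .a ∷ f) refl v with lift p f refl v
  ... | lifted h refl vh y≡ h≤ l≡ = lifted (inj₁ (leaf a) ∷ h) refl (tt , vh) (cong (a ∷_) y≡) h≤ l≡
  lift (keep {a} p) (inj₂ .a ∷ f) refl v with lift p f refl v
  ... | lifted h refl vh y≡ h≤ l≡ = lifted (inj₂ a ∷ h) refl vh (cong (a ∷_) y≡) h≤ l≡

  record Grown (w : List (Cell n t)) (z : List (Fin t)) : Set where
    constructor grown
    field
      forest     : Forest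
      cut≡       : cut forest ≡ w
      valid      : ForestValid forest
      yield≡     : forestYield forest ≡ z
      controlled : ∀ j → j < forestHeight forest → InSLT R (forestLevel j forest)

  grow-leaves : ∀ {w z} → Terms w z → Σ (Grown w z) λ g → forestHeight (Grown.forest g) ≡ 0
  grow-leaves [] = grown [] refl tt refl (λ _ ()) , refl
  grow-leaves (live∷_ {a} p) with grow-leaves p
  ... | grown f refl v refl _ , h = grown (inj₁ (leaf a) ∷ f) refl (tt , v) refl
    (λ j j< → ⊥-elim (ℕ.n≮0 (subst (j <_) h j<))) , h
  grow-leaves (dead∷_ {a} p) with grow-leaves p
  ... | grown f refl v refl _ , h = grown (inj₂ a ∷ f) refl v refl
    (λ j j< → ⊥-elim (ℕ.n≮0 (subst (j <_) h j<))) , h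

  -- The forest grows upwards from the last cut. A step puts a new level on top and shifts the
  -- others by one, so only level 0 has to be checked anew.
  grow : ∀ {w w′ z} → Star LevelStep w w′ → Terms w′ z → Grown w z
  grow ε p = proj₁ (grow-leaves p)
  grow ((x , r) ◅ xs) p with grow xs p
  ... | grown f e v refl c with lift x f e v
  ... | lifted g refl vg y h≤ l≡ = grown g refl vg y λ
    { zero    _  → subst (InSLT R) (sym (level-zero g)) r
    ; (suc j) j< → subst (InSLT R) (sym (l≡ j)) (c j (ℕ.≤-pred (ℕ.≤-trans j< h≤))) }

  -- From trees to sequences of cuts

  mutual
    NonErasing : Tree n t → Set
    NonErasing (leaf a)    = ⊤
    NonErasing (node A ts) = ts ≢ [] × AllNonErasing ts

    AllNonErasing : List (Tree n t) → Set
    AllNonErasing []       = ⊤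
    AllNonErasing (x ∷ xs) = NonErasing x × AllNonErasing xs

  ForestNonErasing : Forest → Set
  ForestNonErasing []           = ⊤
  ForestNonErasing (inj₁ x ∷ f) = NonErasing x × ForestNonErasing f
  ForestNonErasing (inj₂ a ∷ f) = ForestNonErasing f

  Produced : Sym n t → Set
  Produced x = ∃ λ r → r ∈ P × x ∈ proj₂ r

  mutual
    -- A childless node would carry the label `S`, which then occurs on a right-hand side although
    -- an erasing rule is present.
    nonErasing-produced : ∀ x → Produced (label x) → Valid P x → NonErasing x
    nonErasing-produced (leaf a)           _ _        = tt
    nonErasing-produced (node A [])        (r , r∈ , A∈) (p , _) with All.lookup nonErasing p
    ... | inj₁ ne          = ⊥-elim (ne refl)
    ... | inj₂ (refl , S∉) = ⊥-elim (All.lookup S∉ r∈ A∈)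
    nonErasing-produced (node A (x ∷ xs)) _ (p , v) =
      (λ ()) , allNonErasing-produced (x ∷ xs) (λ x∈ → _ , p , x∈) v

    allNonErasing-produced : ∀ xs → (∀ {x} → x ∈ labels xs → Produced x) → ValidAll P xs → AllNonErasing xs
    allNonErasing-produced []       _ _       = tt
    allNonErasing-produced (x ∷ xs) q (v , w) =
      nonErasing-produced x (q (here refl)) v , allNonErasing-produced xs (λ x∈ → q (there x∈)) w

  ne-⧺ : ∀ ts f → AllNonErasing ts → ForestNonErasing f → ForestNonErasing (ts ⧺ f)
  ne-⧺ []       f _        u = u
  ne-⧺ (x ∷ ts) f (v , vs) u = v , ne-⧺ ts f vs u

  next : Forest → Forest
  next []                    = []
  next (inj₁ (leaf a) ∷ f)    = inj₂ a ∷ next f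
  next (inj₁ (node A ts) ∷ f) = ts ⧺ next f
  next (inj₂ a ∷ f)           = inj₂ a ∷ next f

  next-valid : ∀ f → ForestValid f → ForestValid (next f)
  next-valid []                    _             = tt
  next-valid (inj₁ (leaf a) ∷ f)    (_ , v)       = next-valid f v
  next-valid (inj₁ (node A ts) ∷ f) ((_ , w) , v) = valid-⧺⁺ ts (next f) w (next-valid f v)
  next-valid (inj₂ a ∷ f)           v             = next-valid f v

  next-nonErasing : ∀ f → ForestNonErasing f → ForestNonErasing (next f)
  next-nonErasing []                    _             = tt
  next-nonErasing (inj₁ (leaf a) ∷ f)    (_ , v)       = next-nonErasing f v
  next-nonErasing (inj₁ (node A ts) ∷ f) ((_ , w) , v) = ne-⧺ ts (next f) w (next-nonErasing f v)
  next-nonErasing (inj₂ a ∷ f)           v             = next-nonErasing f v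

  next-yield : ∀ f → forestYield (next f) ≡ forestYield f
  next-yield []                    = refl
  next-yield (inj₁ (leaf a) ∷ f)    = cong (a ∷_) (next-yield f)
  next-yield (inj₁ (node A ts) ∷ f) = trans (yield-⧺ ts (next f)) (cong (yields ts ++_) (next-yield f))
  next-yield (inj₂ a ∷ f)           = cong (a ∷_) (next-yield f)

  next-level : ∀ j f → forestLevel j (next f) ≡ forestLevel (suc j) f
  next-level j []                    = refl
  next-level j (inj₁ (leaf a) ∷ f)    = next-level j f
  next-level j (inj₁ (node A ts) ∷ f) = trans (level-⧺ j ts (next f)) (cong (levels j ts ++_) (next-level j f))
  next-level j (inj₂ a ∷ f)           = next-level j f

  pred-⊔ : ∀ m n → m ⊔ pred n ≡ pred (suc m ⊔ n)
  pred-⊔ m zero    = ℕ.⊔-identityʳ m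
  pred-⊔ m (suc n) = refl

  next-height : ∀ f → forestHeight (next f) ≡ pred (forestHeight f)
  next-height []                    = refl
  next-height (inj₁ (leaf a) ∷ f)    = next-height f
  next-height (inj₁ (node A ts) ∷ f) =
    trans (height-⧺ ts (next f)) (trans (cong (heights ts ⊔_) (next-height f)) (pred-⊔ (heights ts) (forestHeight f)))
  next-height (inj₂ a ∷ f)           = next-height f

  expand-next : ∀ f → ForestValid f → ForestNonErasing f → Expand P (cut f) (cut (next f))
  expand-next []                          _ _ = []
  expand-next (inj₁ (leaf a) ∷ f)          (_ , v) (_ , u) = age (expand-next f v u)
  expand-next (inj₁ (node A []) ∷ f)       _ ((ne , _) , _) = ⊥-elim (ne refl)
  expand-next (inj₁ (node A (x ∷ xs)) ∷ f) ((p , _) , v) (_ , u) =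
    subst (Expand P _) (sym (cut-⧺ (x ∷ xs) (next f))) (rule p (expand-next f v u))
  expand-next (inj₂ a ∷ f)                 v u = keep (expand-next f v u)

  terms-leaves : ∀ f → forestHeight f ≡ 0 → Terms (cut f) (forestYield f)
  terms-leaves []                    _ = []
  terms-leaves (inj₁ (leaf a) ∷ f)    h = live∷ terms-leaves f h
  terms-leaves (inj₁ (node A ts) ∷ f) h with forestHeight f
  terms-leaves (inj₁ (node A ts) ∷ f) () | zero
  terms-leaves (inj₁ (node A ts) ∷ f) () | suc _
  terms-leaves (inj₂ a ∷ f)           h = dead∷ terms-leaves f h

  -- The number of steps is exactly the height, so every cut that is left has an index for which
  -- control is given.
  slice : ∀ h f → forestHeight f ≡ h → ForestValid f → ForestNonErasing f →
          (∀ j → j < h → InSLT R (forestLevel j f)) →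
          ∃ λ w → Star LevelStep (cut f) w × Terms w (forestYield f)
  slice zero    f e v u c = cut f , ε , terms-leaves f e
  slice (suc h) f e v u c
    with slice h (next f) (trans (next-height f) (cong pred e)) (next-valid f v) (next-nonErasing f u)
           (λ j j<h → subst (InSLT R) (sym (next-level j f)) (c (suc j) (s≤s j<h)))
  ... | w , p , q = w , (expand-next f v u , subst (InSLT R) (level-zero f) (c 0 (s≤s z≤n))) ◅ p
                  , subst (Terms w) (next-yield f) q

  -- A root without children has height 1, which is why its level 0 is still controlled in the case
  -- of λ.
  Derives : List (Fin t) → Set
  Derives z = (z ≡ [] × (S , []) ∈ P × InSLT R (inj₁ S ∷ []))
            ⊎ ∃ λ w → Star LevelStep (live (inj₁ S) ∷ []) w × Terms w z

  tree→levels : ∀ {z} → TCLang G z → Derives z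
  tree→levels (node A [] , refl , (p , _) , refl , c) = inj₁ (refl , p , c 0 (s≤s z≤n))
  tree→levels (node A (x ∷ xs) , refl , (p , v) , refl , c) = inj₂
    (let w , st , tm = slice _ (inj₁ (node A (x ∷ xs)) ∷ []) (ℕ.⊔-identityʳ _) ((p , v) , tt)
                         (((λ ()) , allNonErasing-produced (x ∷ xs) (λ x∈ → _ , p , x∈) v) , tt)
                         (λ j j< → subst (InSLT R) (sym (List.++-identityʳ _)) (c j j<))
     in w , st , subst (Terms w) (List.++-identityʳ _) tm)

  levels→tree : ∀ {z} → Derives z → TCLang G z
  levels→tree (inj₁ (refl , p , r)) = node S [] , refl , (p , tt) , refl , λ { zero _ → r ; (suc _) (s≤s ()) }
  levels→tree (inj₂ (w , st , tm)) with grow st tm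
  ... | grown (inj₁ x ∷ []) e (v , _) refl c =
    x , live-injective (proj₁ (List.∷-injective e)) , v , sym (List.++-identityʳ _) ,
    λ j j< → subst (InSLT R) (List.++-identityʳ _)
      (c j (subst (j <_) (sym (ℕ.⊔-identityʳ (height x))) j<))
    where
    live-injective : ∀ {x y : Sym n t} → live x ≡ live y → x ≡ y
    live-injective refl = refl
  ... | grown (inj₁ x ∷ inj₁ _ ∷ _) () _ _ _
  ... | grown (inj₁ x ∷ inj₂ _ ∷ _) () _ _ _

  language : ∀ z → TCLang G z ⇔ Derives z
  language z = mk⇔ tree→levels levels→tree

-- Windows and automata for strictly locally testable languages

module _ {A : Set} where

  windows-long : ∀ k (a : A) w → k ≤ length (a ∷ w) → windows k (a ∷ w) ≡ take k (a ∷ w) ∷ windows k w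
  windows-long k a w k≤ with k ≤? length (a ∷ w)
  ... | yes _ = refl
  ... | no k≰ = ⊥-elim (k≰ k≤)

  windows-short : ∀ k (w : List A) → length w < k → windows k w ≡ []
  windows-short k []      _  = refl
  windows-short k (a ∷ w) <k with k ≤? length (a ∷ w)
  ... | yes k≤ = ⊥-elim (ℕ.<⇒≱ <k k≤)
  ... | no _   = refl

  first-∷ʳ : ∀ (l : List A) {x} → l ≢ [] → take 1 (l ++ x ∷ []) ≡ take 1 l
  first-∷ʳ []      ne = ⊥-elim (ne refl)
  first-∷ʳ (_ ∷ _) ne = refl

  last-∷ : ∀ (x y : A) ys → take 1 (reverse (x ∷ y ∷ ys)) ≡ take 1 (reverse (y ∷ ys))
  last-∷ x y ys = trans (cong (take 1) (List.unfold-reverse x (y ∷ ys))) (first-∷ʳ (reverse (y ∷ ys)) nonempty)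
    where
    nonempty : reverse (y ∷ ys) ≢ []
    nonempty e with reverse ys | trans (sym (List.unfold-reverse y ys)) e
    ... | []    | ()
    ... | _ ∷ _ | ()

module Windows {V : Set} {k : ℕ} (D : SLTDesc V k) where
  open SLTDesc D

  -- `Tail` and `Long` turn the separate conditions on first, inner and last windows into one
  -- recursion from the left, the form that an automaton can follow. A single window must lie in
  -- both `B` and `E`.
  Tail : List (List V) → Set
  Tail []           = ⊤
  Tail (x ∷ [])     = x ∈ E
  Tail (x ∷ y ∷ ys) = x ∈ I × Tail (y ∷ ys)

  Long : List (List V) → Set
  Long []           = ⊤
  Long (x ∷ [])     = x ∈ B × x ∈ E
  Long (x ∷ y ∷ ys) = x ∈ B × Tail (y ∷ ys)

  private
    Ends : List (List V) → Set
    Ends ws = All (_∈ E) (take 1 (reverse ws))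

  tail⇔ : ∀ y ys → (Ends (y ∷ ys) × All (_∈ I) (dropLast (y ∷ ys))) ⇔ Tail (y ∷ ys)
  tail⇔ y []       = mk⇔ (λ { (e ∷ [] , _) → e }) (λ e → e ∷ [] , [])
  tail⇔ y (z ∷ zs) = mk⇔
    (λ { (e , i ∷ is) → i , Equivalence.to (tail⇔ z zs) (subst (All _) (last-∷ y z zs) e , is) })
    (λ { (i , r) → let e , is = Equivalence.from (tail⇔ z zs) r in
                   subst (All _) (sym (last-∷ y z zs)) e , i ∷ is })

  long⇔ : ∀ ws → (All (_∈ B) (take 1 ws) × Ends ws × All (_∈ I) (dropLast (drop 1 ws))) ⇔ Long ws
  long⇔ []           = mk⇔ (λ _ → tt) (λ _ → [] , [] , [])
  long⇔ (x ∷ [])     = mk⇔ (λ { (b ∷ [] , e ∷ [] , _) → b , e }) (λ { (b , e) → b ∷ [] , e ∷ [] , [] })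
  long⇔ (x ∷ y ∷ ys) = mk⇔
    (λ { (b ∷ [] , e , i) → b , Equivalence.to (tail⇔ y ys) (subst (All _) (last-∷ x y ys) e , i) })
    (λ { (b , r) → let e , i = Equivalence.from (tail⇔ y ys) r in
                   b ∷ [] , subst (All _) (sym (last-∷ x y ys)) e , i })

  inSLT-long : ∀ {w} → k ≤ length w → InSLT D w ⇔ Long (windows k w)
  inSLT-long {w} k≤ = mk⇔
    (λ { (inj₁ w∈F) → ⊥-elim (ℕ.<⇒≱ (All.lookup F-len w∈F) k≤)
       ; (inj₂ (_ , c)) → Equivalence.to (long⇔ (windows k w)) c })
    (λ l → inj₂ (k≤ , Equivalence.from (long⇔ (windows k w)) l))

  inSLT-short : ∀ {w} → length w < k → InSLT D w ⇔ w ∈ F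
  inSLT-short <k = mk⇔ (λ { (inj₁ w∈F) → w∈F ; (inj₂ (k≤ , _)) → ⊥-elim (ℕ.<⇒≱ <k k≤) }) inj₁

infixr 5 _∷_
-- Words of length at most `k` as a type of their own, so that they can be listed and serve as
-- states.
data Bounded (V : Set) : ℕ → Set where
  []  : ∀ {k} → Bounded V k
  _∷_ : ∀ {k} → V → Bounded V k → Bounded V (suc k)

listable-Bounded : {V : Set} → Listable V → ∀ k → Listable (Bounded V k)
listable-Bounded lV zero    = listable-image (λ _ → []) (λ { [] → tt , refl }) listable-⊤
listable-Bounded lV (suc k) = listable-image
  (λ { nothing → [] ; (just (a , w)) → a ∷ w })
  (λ { [] → nothing , refl ; (a ∷ w) → just (a , w) , refl })
  (listable-Maybe (listable-× lV (listable-Bounded lV k)))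

module _ {V : Set} where

  push : ∀ {k} → V → Bounded V k → Bounded V k
  push {zero}  a []      = []
  push {suc k} a []      = a ∷ []
  push {suc k} a (b ∷ w) = a ∷ push b w

  toList : ∀ {k} → Bounded V k → List V
  toList []      = []
  toList (a ∷ w) = a ∷ toList w

  toList-push : ∀ {k} a (w : Bounded V k) → toList (push a w) ≡ take k (a ∷ toList w)
  toList-push {zero}        a []      = refl
  toList-push {suc zero}    a []      = refl
  toList-push {suc (suc k)} a []      = refl
  toList-push {suc k}       a (b ∷ w) = cong (a ∷_) (toList-push b w)

  take-∷-take : ∀ k (a : V) w → take k (a ∷ take k w) ≡ take k (a ∷ w)
  take-∷-take zero    a w       = refl
  take-∷-take (suc k) a []      = refl
  take-∷-take (suc k) a (b ∷ w) = cong (a ∷_) (take-∷-take k b w)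

-- Reading a word from right to left, the automaton keeps its prefix of length
-- at most k, whether the word is longer than k, and whether all windows but
-- the first one are admissible.
module Automaton {V : Set} (listV : Listable V) {k : ℕ} (k≥1 : 1 ≤ k) (D : SLTDesc V k) where
  open SLTDesc D
  open Windows D
  open DecMembership (List.≡-dec (Listable._≟_ listV)) using (_∈?_)

  State : Set
  State = Bounded V k × Bool × Bool

  states : Listable State
  states = listable-× (listable-Bounded listV k) (listable-× listable-Bool listable-Bool)

  full : List V → Bool
  full w = k <ᵇ suc (length w)

  -- A further letter turns the first window of the word read so far into a later one, and only then
  -- is it judged: by `E` if it was the only window, otherwise by `I` together with the earlier
  -- verdict.
  check : (isFull isLonger ok : Bool) → List V → Bool
  check false _     _  x = true
  check true  false _  x = ⌊ x ∈? E ⌋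
  check true  true  ok x = ⌊ x ∈? I ⌋ ∧ ok

  initial : State
  initial = [] , false , true

  δ : V → State → State
  δ a (w , longer , ok) = push a w , full (toList w) , check (full (toList w)) longer ok (toList w)

  accepting : (isFull isLonger ok : Bool) → List V → Bool
  accepting false _     _  x = ⌊ x ∈? F ⌋
  accepting true  false _  x = ⌊ x ∈? B ⌋ ∧ ⌊ x ∈? E ⌋
  accepting true  true  ok x = ⌊ x ∈? B ⌋ ∧ ok

  accept : State → Bool
  accept (w , longer , ok) = accepting (full (toList w)) longer ok (toList w)

  private
    <ᵇ-true : ∀ m n → m < n → (m <ᵇ n) ≡ true
    <ᵇ-true m n m<n = Equivalence.to T-≡ (ℕ.<⇒<ᵇ m<n)

    <ᵇ-false : ∀ m n → ¬ m < n → (m <ᵇ n) ≡ false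
    <ᵇ-false m n m≮n = ¬-not λ e → m≮n (ℕ.<ᵇ⇒< m n (Equivalence.from T-≡ e))

    T-⌊∈⌋ : ∀ {x L} → T ⌊ x ∈? L ⌋ ⇔ x ∈ L
    T-⌊∈⌋ = mk⇔ toWitness fromWitness

    _⊗_ : ∀ {a b} {P Q : Set} → T a ⇔ P → T b ⇔ Q → T (a ∧ b) ⇔ (P × Q)
    f ⊗ g = mk⇔
      (λ t → let p , q = Equivalence.to T-∧ t in Equivalence.to f p , Equivalence.to g q)
      (λ { (p , q) → Equivalence.from T-∧ (Equivalence.from f p , Equivalence.from g q) })

  full-true : ∀ w → k ≤ length w → full w ≡ true
  full-true w k≤ = <ᵇ-true k (suc (length w)) (s≤s k≤)

  full-false : ∀ w → length w < k → full w ≡ false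
  full-false w <k = <ᵇ-false k (suc (length w)) λ { (s≤s k≤) → ℕ.<⇒≱ <k k≤ }

  take-whole : ∀ (w : List V) → length w ≤ k → take k w ≡ w
  take-whole w ≤k = List.take-all k w ≤k

  run : List V → State
  run = foldr δ initial

  prefix : ∀ w → toList (proj₁ (run w)) ≡ take k w
  prefix []      = sym (List.take-[] k)
  prefix (a ∷ w) = trans (toList-push a (proj₁ (run w)))
                     (trans (cong (λ x → take k (a ∷ x)) (prefix w)) (take-∷-take k a w))

  full-prefix : ∀ w → full (toList (proj₁ (run w))) ≡ full w
  full-prefix w with k ≤? length w
  ... | yes k≤ = trans (cong full (prefix w)) (trans (full-true (take k w) (ℕ.≤-reflexive
    (sym (trans (List.length-take k w) (ℕ.m≤n⇒m⊓n≡m k≤))))) (sym (full-true w k≤)))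
  ... | no k≰  = cong full (trans (prefix w) (take-whole w (ℕ.<⇒≤ (ℕ.≰⇒> k≰))))

  longer : ∀ w → proj₁ (proj₂ (run w)) ≡ (k <ᵇ length w)
  longer []      = refl
  longer (a ∷ w) = full-prefix w

  -- The lengths below, equal to and above `k`, each with the equations that let `check` and
  -- `accepting` compute.
  data Shape (w : List V) : Set where
    short : length w < k → full w ≡ false → windows k w ≡ [] → Shape w
    exact : k ≤ length w → full w ≡ true → (k <ᵇ length w) ≡ false → windows k w ≡ take k w ∷ [] → Shape w
    long  : ∀ {y ys} → k ≤ length w → full w ≡ true → (k <ᵇ length w) ≡ true →
            drop 1 (windows k w) ≡ y ∷ ys → windows k w ≡ take k w ∷ y ∷ ys → Shape w

  shape : ∀ w → Shape w
  shape w with k ≤? length w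
  ... | no k≰ = short (ℕ.≰⇒> k≰) (full-false w (ℕ.≰⇒> k≰)) (windows-short k w (ℕ.≰⇒> k≰))
  -- Here `k ≥ 1` enters: for `k = 0` the empty word would count as full although it has no window.
  shape [] | yes k≤ = ⊥-elim (ℕ.<⇒≱ k≥1 k≤)
  shape (a ∷ w) | yes k≤ with k ≤? length w
  ... | no k≰ = exact k≤ (full-true (a ∷ w) k≤) (<ᵇ-false k (length (a ∷ w)) λ { (s≤s k≤) → k≰ k≤ })
          (trans (windows-long k a w k≤) (cong (take k (a ∷ w) ∷_) (windows-short k w (ℕ.≰⇒> k≰))))
  shape (a ∷ []) | yes k≤ | yes k≤0 = ⊥-elim (ℕ.<⇒≱ k≥1 k≤0)
  shape (a ∷ b ∷ w) | yes k≤ | yes k≤′ =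
    long k≤ (full-true (a ∷ b ∷ w) k≤) (full-true (b ∷ w) k≤′) (cong (drop 1) eq) eq
    where
    eq = trans (windows-long k a (b ∷ w) k≤) (cong (take k (a ∷ b ∷ w) ∷_) (windows-long k b w k≤′))

  drop-windows : ∀ a (w : List V) → windows k w ≡ [] → drop 1 (windows k (a ∷ w)) ≡ []
  drop-windows a w ws with k ≤? length (a ∷ w)
  ... | yes _ = ws
  ... | no _  = refl

  drop-long : ∀ a (w : List V) → k ≤ length w → drop 1 (windows k (a ∷ w)) ≡ windows k w
  drop-long a w k≤ = cong (drop 1) (windows-long k a w (ℕ.m≤n⇒m≤1+n k≤))

  ok : ∀ w → T (proj₂ (proj₂ (run w))) ⇔ Tail (drop 1 (windows k w))
  ok [] = mk⇔ (λ _ → tt) (λ _ → tt)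
  ok (a ∷ w) rewrite full-prefix w | longer w | prefix w with shape w
  ... | short <k f ws rewrite f =
    subst (λ v → ⊤ ⇔ Tail v) (sym (drop-windows a w ws)) (mk⇔ (λ _ → tt) (λ _ → tt))
  ... | exact k≤ f l ws rewrite f | l =
    subst (λ v → T ⌊ take k w ∈? E ⌋ ⇔ Tail v) (sym (trans (drop-long a w k≤) ws)) T-⌊∈⌋
  ... | long k≤ f l d ws rewrite f | l =
    subst (λ v → T (⌊ take k w ∈? I ⌋ ∧ proj₂ (proj₂ (run w))) ⇔ Tail v) (sym (trans (drop-long a w k≤) ws))
      (T-⌊∈⌋ ⊗ subst (λ v → T (proj₂ (proj₂ (run w))) ⇔ Tail v) d (ok w))

  correct : ∀ w → T (accept (run w)) ⇔ InSLT D w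
  correct w rewrite full-prefix w | longer w | prefix w with shape w
  ... | short <k f ws rewrite f =
    subst (λ v → T ⌊ v ∈? F ⌋ ⇔ InSLT D w) (sym (take-whole w (ℕ.<⇒≤ <k))) (mk⇔
      (λ t → Equivalence.from (inSLT-short <k) (Equivalence.to T-⌊∈⌋ t))
      (λ s → Equivalence.from T-⌊∈⌋ (Equivalence.to (inSLT-short <k) s)))
  ... | exact k≤ f l ws rewrite f | l = mk⇔
    (λ t → Equivalence.from (inSLT-long k≤) (subst Long (sym ws) (Equivalence.to (T-⌊∈⌋ ⊗ T-⌊∈⌋) t)))
    (λ s → Equivalence.from (T-⌊∈⌋ ⊗ T-⌊∈⌋) (subst Long ws (Equivalence.to (inSLT-long k≤) s)))
  ... | long k≤ f l d ws rewrite f | l = mk⇔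
    (λ t → Equivalence.from (inSLT-long k≤) (subst Long (sym ws) (Equivalence.to both t)))
    (λ s → Equivalence.from both (subst Long ws (Equivalence.to (inSLT-long k≤) s)))
    where
    both = T-⌊∈⌋ ⊗ subst (λ v → T (proj₂ (proj₂ (run w))) ⇔ Tail v) d (ok w)

-- From tree-controlled to context-sensitive grammars

listable-Sym : ∀ n t → Listable (Sym n t)
listable-Sym n t = listable-⊎ (listable-Fin n) (listable-Fin t)

listable-Cell : ∀ n t → Listable (Cell n t)
listable-Cell n t = listable-image
  (λ { (inj₁ x) → live x ; (inj₂ a) → dead a })
  (λ { (live x) → inj₁ x , refl ; (dead a) → inj₂ a , refl })
  (listable-⊎ (listable-Sym n t) (listable-Fin t))

-- A cut is rewritten into the next one from right to left, while the automaton
-- for R reads the level; if it accepts, the head returns to the right end.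
module LevelMachine {n t k : ℕ} (k≥1 : 1 ≤ k) (G : TCGrammarSLT n t k) where
  open TCGrammarSLT G
  open Levels G using (LevelStep; Derives)
  module A = Automaton (listable-Sym n t) k≥1 R

  -- Splitting off the first symbol gives the head a cell to stand on after an expansion.
  nonempty : List (Rule n t) → List (Fin n × Sym n t × List (Sym n t))
  nonempty []                 = []
  nonempty ((B , []) ∷ Q)     = nonempty Q
  nonempty ((B , x ∷ xs) ∷ Q) = (B , x , xs) ∷ nonempty Q

  ∈-nonempty⁺ : ∀ {B x xs} Q → (B , x ∷ xs) ∈ Q → (B , x , xs) ∈ nonempty Q
  ∈-nonempty⁺ ((_ , [])    ∷ Q) (there r) = ∈-nonempty⁺ Q r
  ∈-nonempty⁺ ((_ , _ ∷ _) ∷ Q) (here refl) = here refl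
  ∈-nonempty⁺ ((_ , _ ∷ _) ∷ Q) (there r) = there (∈-nonempty⁺ Q r)

  ∈-nonempty⁻ : ∀ {B x xs} Q → (B , x , xs) ∈ nonempty Q → (B , x ∷ xs) ∈ Q
  ∈-nonempty⁻ ((_ , [])    ∷ Q) r           = there (∈-nonempty⁻ Q r)
  ∈-nonempty⁻ ((_ , _ ∷ _) ∷ Q) (here refl) = here refl
  ∈-nonempty⁻ ((_ , _ ∷ _) ∷ Q) (there r)   = there (∈-nonempty⁻ Q r)

  P⁺ : List (Fin n × Sym n t × List (Sym n t))
  P⁺ = nonempty P

  data Expansion : Set where
    byRule      : Fin (length P⁺) → Expansion
    aging fixed : Fin t → Expansion

  source head : Expansion → Cell n t
  source (byRule i) = live (inj₁ (proj₁ (lookup P⁺ i)))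
  source (aging a)  = live (inj₂ a)
  source (fixed a)  = dead a
  head (byRule i) = live (proj₁ (proj₂ (lookup P⁺ i)))
  head (aging a)  = dead a
  head (fixed a)  = dead a

  tail : Expansion → List (Cell n t)
  tail (byRule i) = map live (proj₂ (proj₂ (lookup P⁺ i)))
  tail (aging a)  = []
  tail (fixed a)  = []

  expand⁺ : ∀ e {w w′} → Expand P w w′ → Expand P (source e ∷ w) (head e ∷ tail e ++ w′)
  expand⁺ (byRule i) p = rule (∈-nonempty⁻ P (∈-lookup i)) p
  expand⁺ (aging a)  p = age p
  expand⁺ (fixed a)  p = keep p

  data Expand⁻ (c : Cell n t) (w w′ : List (Cell n t)) : Set where
    by : ∀ e {w″} → c ≡ source e → Expand P w w″ → w′ ≡ head e ∷ tail e ++ w″ → Expand⁻ c w w′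

  expand⁻ : ∀ {c w w′} → Expand P (c ∷ w) w′ → Expand⁻ c w w′
  expand⁻ (rule {x = x} {xs} r∈ p) =
    by (byRule (index i)) (cong (live ∘ inj₁ ∘ proj₁) e) p
       (cong₂ (λ y ys → live y ∷ map live ys ++ _) (cong (proj₁ ∘ proj₂) e) (cong (proj₂ ∘ proj₂) e))
    where
    i = ∈-nonempty⁺ P r∈
    e = lookup-index i
  expand⁻ (age p)  = by (aging _) refl p refl
  expand⁻ (keep p) = by (fixed _) refl p refl

  update : Cell n t → A.State → A.State
  update (live x) q = A.δ x q
  update (dead a) q = q

  state : List (Cell n t) → A.State
  state = foldr update A.initial

  state-run : ∀ w → state w ≡ A.run (liveSyms w)
  state-run []           = refl
  state-run (live x ∷ w) = cong (A.δ x) (state-run w)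
  state-run (dead a ∷ w) = state-run w

  accepted : ∀ w → T (A.accept (state w)) ⇔ InSLT R (liveSyms w)
  accepted w = subst (λ q → T (A.accept q) ⇔ InSLT R (liveSyms w)) (sym (state-run w)) (A.correct (liveSyms w))

  -- `sweep` stands on a cell still to be expanded, `carry` on the first cell of a finished
  -- expansion whose source has been read; they differ because a move either rewrites or shifts the
  -- head. In `back` the head travels to the right end, where it chooses between another sweep and
  -- the output phase `popping`.
  data Phase : Set where
    sweep carry  : A.State → Phase
    back popping : Phase

  data Local (l r : Bool) : Set where
    expand    : A.State → Expansion → Local l r
    accept    : T l → (q : A.State) → T (A.accept q) → Cell n t → Local l r
    restart   : T r → Cell n t → Local l r
    terminate : T r → Cell n t → Local l r

  listable-Expansion : Listable Expansion
  listable-Expansion = listable-image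
    (λ { (inj₁ i) → byRule i ; (inj₂ (inj₁ a)) → aging a ; (inj₂ (inj₂ a)) → fixed a })
    (λ { (byRule i) → inj₁ i , refl ; (aging a) → inj₂ (inj₁ a) , refl ; (fixed a) → inj₂ (inj₂ a) , refl })
    (listable-⊎ (listable-Fin _) (listable-⊎ (listable-Fin t) (listable-Fin t)))

  listable-Phase : Listable Phase
  listable-Phase = listable-image
    (λ { (inj₁ q) → sweep q ; (inj₂ (inj₁ q)) → carry q ; (inj₂ (inj₂ true)) → back ; (inj₂ (inj₂ false)) → popping })
    (λ { (sweep q) → inj₁ q , refl ; (carry q) → inj₂ (inj₁ q) , refl
       ; back → inj₂ (inj₂ true) , refl ; popping → inj₂ (inj₂ false) , refl })
    (listable-⊎ A.states (listable-⊎ A.states listable-Bool))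

  listable-Local : ∀ l r → Listable (Local l r)
  listable-Local l r = listable-image
    (λ { (inj₁ (q , e)) → expand q e ; (inj₂ (inj₁ (h , q , a , c))) → accept h q a c
       ; (inj₂ (inj₂ (h , true , c))) → restart h c ; (inj₂ (inj₂ (h , false , c))) → terminate h c })
    (λ { (expand q e) → inj₁ (q , e) , refl ; (accept h q a c) → inj₂ (inj₁ (h , q , a , c)) , refl
       ; (restart h c) → inj₂ (inj₂ (h , true , c)) , refl ; (terminate h c) → inj₂ (inj₂ (h , false , c)) , refl })
    (listable-⊎ (listable-× A.states listable-Expansion)
      (listable-⊎ (listable-× (listable-T l) (listable-Σ A.states λ q →
                     listable-× (listable-T (A.accept q)) (listable-Cell n t)))
                  (listable-× (listable-T r) (listable-× listable-Bool (listable-Cell n t)))))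

  terminalCell : Fin t ⊎ Fin t → Cell n t
  terminalCell (inj₁ a) = live (inj₂ a)
  terminalCell (inj₂ a) = dead a

  terminal : Fin t ⊎ Fin t → Fin t
  terminal (inj₁ a) = a
  terminal (inj₂ a) = a

  machine : Machine t
  machine = record
    { State = Phase
    ; Cell = Cell n t
    ; states = listable-Phase
    ; cells = listable-Cell n t
    ; Local = Local
    ; locals = listable-Local
    ; localFrom = λ { (expand q e) → sweep q ; (accept _ q _ _) → carry q
                    ; (restart _ _) → back ; (terminate _ _) → back }
    ; localTo = λ { (expand q e) → carry (update (source e) q) ; (accept _ _ _ _) → back
                  ; (restart _ _) → sweep A.initial ; (terminate _ _) → popping }
    ; localCell = λ { (expand _ e) → source e ; (accept _ _ _ c) → c ; (restart _ c) → c ; (terminate _ c) → c }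
    ; localHead = λ { (expand _ e) → head e ; (accept _ _ _ c) → c ; (restart _ c) → c ; (terminate _ c) → c }
    ; localTail = λ { (expand _ e) → tail e ; (accept _ _ _ _) → [] ; (restart _ _) → [] ; (terminate _ _) → [] }
    ; LeftMove = A.State
    ; RightMove = ⊤
    ; leftMoves = A.states
    ; rightMoves = listable-⊤
    ; leftFrom = carry
    ; leftTo = sweep
    ; rightFrom = λ _ → back
    ; rightTo = λ _ → back
    ; Pop = Fin t ⊎ Fin t
    ; pops = listable-⊎ (listable-Fin t) (listable-Fin t)
    ; popFrom = λ _ → popping
    ; popTo = λ _ → popping
    ; popCell = terminalCell
    ; popOutput = terminal }

  -- Correctness of the level machine

  open Machine machine using (Config; run; done; _⊢_; local; left; right; pop; finish)

  Reachable : List (Cell n t) → Set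
  Reachable w = Star LevelStep (live (inj₁ S) ∷ []) w

  -- During a sweep the tape mixes two cuts, the old one to the left and the new one to the right.
  -- The word `p` is the old content of the part already expanded, so the whole old cut is known
  -- when the automaton accepts. In `popping`, `w` plays this part for the cells already output.
  Invariant : Config → Set
  Invariant (run u (sweep q) c v z) =
    z ≡ [] × ∃ λ p → Reachable (u ʳ++ c ∷ p) × Expand P p v × q ≡ state p
  Invariant (run u (carry q) c v z) =
    z ≡ [] × ∃ λ p → Reachable (u ʳ++ p) × Expand P p (c ∷ v) × q ≡ state p
  Invariant (run u back c v z) = z ≡ [] × Reachable (u ʳ++ c ∷ v)
  Invariant (run u popping c v z) = v ≡ [] × ∃ λ w → Reachable (u ʳ++ c ∷ w) × Terms w z
  Invariant (done z) = ∃ λ w → Reachable w × Terms w z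

  terms-∷ : ∀ i {w z} → Terms w z → Terms (terminalCell i ∷ w) (terminal i ∷ z)
  terms-∷ (inj₁ a) p = live∷ p
  terms-∷ (inj₂ a) p = dead∷ p

  invariant-step : ∀ {χ χ′} → χ ⊢ χ′ → Invariant χ → Invariant χ′
  invariant-step (local (expand q e) _ _) (z≡ , p , rc , x , refl) = z≡ , source e ∷ p , rc , expand⁺ e x , refl
  invariant-step (local {u = []} (accept _ q a c) _ _) (z≡ , p , rc , x , refl) =
    z≡ , rc ◅◅ ((x , Equivalence.to (accepted p) a) ◅ ε)
  invariant-step (local {u = _ ∷ _} (accept () _ _ _) refl _) _
  invariant-step (local {v = []} (restart _ c) _ _) (z≡ , rc) = z≡ , [] , rc , [] , refl
  invariant-step (local {v = _ ∷ _} (restart () _) _ refl) _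
  invariant-step (local {v = []} (terminate _ c) _ _) (refl , rc) = refl , [] , rc , []
  invariant-step (local {v = _ ∷ _} (terminate () _) _ refl) _
  -- With `ʳ++` the tape reads definitionally the same from both head positions.
  invariant-step (left q) inv = inv
  invariant-step (right _) inv = inv
  invariant-step (pop i) (_ , w , rc , p) = refl , _ , rc , terms-∷ i p
  invariant-step (finish i) (_ , w , rc , p) = _ , rc , terms-∷ i p

  invariant-steps : ∀ {χ χ′} → Star _⊢_ χ χ′ → Invariant χ → Invariant χ′
  invariant-steps ε        inv = inv
  invariant-steps (p ◅ ps) inv = invariant-steps ps (invariant-step p inv)

  atEnd : List (Cell n t) → Phase → Cell n t → List (Cell n t) → Config
  atEnd u κ x []      = run u κ x [] []
  atEnd u κ x (y ∷ w) = atEnd (x ∷ u) κ y w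

  go-right : ∀ u x w → Star _⊢_ (run u back x w []) (atEnd u back x w)
  go-right u x []      = ε
  go-right u x (y ∷ w) = right tt ◅ go-right (x ∷ u) y w

  atEnd-restart : ∀ u x w → atEnd u back x w ⊢ atEnd u (sweep A.initial) x w
  atEnd-restart u x []      = local (restart {r = true} tt x) refl refl
  atEnd-restart u x (y ∷ w) = atEnd-restart (x ∷ u) y w

  atEnd-terminate : ∀ u x w → atEnd u back x w ⊢ atEnd u popping x w
  atEnd-terminate u x []      = local (terminate {r = true} tt x) refl refl
  atEnd-terminate u x (y ∷ w) = atEnd-terminate (x ∷ u) y w

  data Swept (u : List (Cell n t)) (χ : Config) (w : List (Cell n t)) : List (Cell n t) → Set where
    swept : ∀ {c v} → Star _⊢_ χ (run u (carry (state w)) c v []) → Swept u χ w (c ∷ v)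

  -- `Expand` is built from the left but executed from the right: the recursive call sweeps the
  -- tail, and then the head moves left onto `x`.
  sweep-all : ∀ u x w {w′} → Expand P (x ∷ w) w′ → Swept u (atEnd u (sweep A.initial) x w) (x ∷ w) w′
  sweep-all u x [] p with expand⁻ p
  ... | by e refl [] refl = swept (local (expand A.initial e) refl refl ◅ ε)
  sweep-all u x (y ∷ w) p with expand⁻ p
  ... | by e refl p′ refl with sweep-all (x ∷ u) y w p′
  ... | swept st = swept (st ◅◅ (left _ ◅ local (expand _ e) refl refl ◅ ε))

  simulate-step : ∀ x w {w′} → LevelStep (x ∷ w) w′ →
                  ∃ λ c → ∃ λ v → w′ ≡ c ∷ v × Star _⊢_ (atEnd [] back x w) (atEnd [] back c v)
  simulate-step x w (p , r) with sweep-all [] x w p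
  ... | swept {c} {v} st = c , v , refl ,
    atEnd-restart [] x w ◅ st ◅◅
      (local (accept {l = true} tt _ (Equivalence.from (accepted (x ∷ w)) r) c) refl refl ◅ go-right [] c v)

  unload : ∀ u x w {z} → Terms w z → Star _⊢_ (atEnd u popping x w) (run u popping x [] z)
  unload u x []                   []        = ε
  unload u x (live (inj₂ a) ∷ w) (live∷ p) = unload (x ∷ u) _ w p ◅◅ (pop (inj₁ a) ◅ ε)
  unload u x (dead a ∷ w)        (dead∷ p) = unload (x ∷ u) _ w p ◅◅ (pop (inj₂ a) ◅ ε)

  simulate-end : ∀ x w {z} → Terms (x ∷ w) z → Star _⊢_ (atEnd [] back x w) (done z)
  simulate-end _ w (live∷ p) = atEnd-terminate [] _ w ◅ unload [] _ w p ◅◅ (finish (inj₁ _) ◅ ε)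
  simulate-end _ w (dead∷ p) = atEnd-terminate [] _ w ◅ unload [] _ w p ◅◅ (finish (inj₂ _) ◅ ε)

  simulate : ∀ x w {w′ z} → Star LevelStep (x ∷ w) w′ → Terms w′ z → Star _⊢_ (atEnd [] back x w) (done z)
  simulate x w ε        tm = simulate-end x w tm
  simulate x w (p ◅ ps) tm with simulate-step x w p
  ... | c , v , refl , st = st ◅◅ simulate c v ps tm

  machine-language : ∀ z → (∃ λ w → Reachable w × Terms w z) ⇔
                     Star _⊢_ (run [] back (live (inj₁ S)) [] []) (done z)
  machine-language z = mk⇔
    (λ { (w , st , tm) → simulate _ [] st tm })
    (λ st → invariant-steps st (refl , ε))

  open DecMembership (Product.≡-dec (Fin._≟_ {n}) (List.≡-dec (Listable._≟_ (listable-Sym n t)))) using (_∈?_)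

  -- The answer decides which grammar is built, so it has to be computed; membership in `R` is
  -- decided by running the automaton.
  derivesλ? : Dec ((S , []) ∈ P × InSLT R (inj₁ S ∷ []))
  derivesλ? = ((S , []) ∈? P) ×-dec
    map′ (Equivalence.to (A.correct _)) (Equivalence.from (A.correct _)) (T? (A.accept (A.run (inj₁ S ∷ []))))

  module Pair = MachineToPair machine
  module CS = PairToCS Pair.grammar (Pair.initial back (live (inj₁ S))) ⌊ derivesλ? ⌋

  derives⇔ : ∀ z → Derives z ⇔ CSLang CS.CS.grammar z
  derives⇔ z = mk⇔
    (λ { (inj₁ (z≡ , λ-ok)) → from (CS.language z) (inj₁ (fromWitness {a? = derivesλ?} λ-ok , z≡))
       ; (inj₂ d) → from (CS.language z) (inj₂ (to (Pair.language back _ z) (to (machine-language z) d))) })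
    (λ d → [ (λ { (h , z≡) → inj₁ (z≡ , toWitness {a? = derivesλ?} h) })
           , (λ st → inj₂ (from (machine-language z) (from (Pair.language back _ z) st)))
           ]′ (to (CS.language z) d))
    where
    open Equivalence

TC⊆CS : ∀ {k t L} → 1 ≤ k → InTC-SLTk k t L → InCS t L
TC⊆CS k≥1 (n , G , L⇔) =
  _ , M.CS.CS.grammar , λ z → M.derives⇔ z ⇔-∘ (Levels.language G z ⇔-∘ L⇔ z)
  where module M = LevelMachine k≥1 G

-- Conditions on adjacent symbols as strictly locally k-testable languages

module TwoLocal {V : Set} (Follows : V → V → Set) where

  Chain : (V → Set) → V → List V → Set
  Chain last a []      = last a
  Chain last a (b ∷ w) = Follows a b × Chain last b w

  Word : (V → Set) → (V → Set) → List V → Set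
  Word first last []      = ⊤
  Word first last (a ∷ w) = first a × Chain last a w

  Free : V → Set
  Free _ = ⊤

  chain-take : ∀ {last} m a w → Chain last a w → Chain Free a (take m w)
  chain-take zero    a w       _       = tt
  chain-take (suc m) a []      _       = tt
  chain-take (suc m) a (b ∷ w) (f , c) = f , chain-take m b w c

  module _ (follows? : ∀ a b → Dec (Follows a b)) where

    chain? : ∀ {last} → Decidable last → ∀ a w → Dec (Chain last a w)
    chain? l? a []      = l? a
    chain? l? a (b ∷ w) = follows? a b ×-dec chain? l? b w

    word? : ∀ {first last} → Decidable first → Decidable last → Decidable (Word first last)
    word? f? l? []      = yes tt
    word? f? l? (a ∷ w) = f? a ×-dec chain? l? a w

module TwoLocalSLT
  {V : Set} (listV : Listable V)
  {First Last : V → Set} {Follows : V → V → Set}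
  (first? : Decidable First) (last? : Decidable Last) (follows? : ∀ a b → Dec (Follows a b))
  (k-2 : ℕ) where
  open TwoLocal Follows

  private
    k : ℕ
    k = suc (suc k-2)

    free? : Decidable Free
    free? _ = yes tt

    word : ∀ {first last} → Decidable first → Decidable last → Decidable (Word first last)
    word = word? follows?

  upToLength : List (List V)
  upToLength = map toList (elems (listable-Bounded listV k))

  upToLength-complete : ∀ {w} → length w ≤ k → w ∈ upToLength
  upToLength-complete {w} l with bounded k w l
    where
    bounded : ∀ m w → length w ≤ m → ∃ λ (b : Bounded V m) → toList b ≡ w
    bounded m       []      _       = [] , refl
    bounded (suc m) (a ∷ w) (s≤s l) with bounded m w l
    ... | b , refl = a ∷ b , refl
  ... | b , refl = ∈-map⁺ toList (complete (listable-Bounded listV k) b)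

  windowsOf : {Q : List V → Set} → Decidable Q → List (List V)
  windowsOf Q? = filter (λ w → (length w ℕ.≟ k) ×-dec Q? w) upToLength

  windowsOf-length : ∀ {Q : List V → Set} (Q? : Decidable Q) → All (λ w → length w ≡ k) (windowsOf Q?)
  windowsOf-length Q? = All.tabulate λ w∈ →
    proj₁ (proj₂ (∈-filter⁻ (λ w → (length w ℕ.≟ k) ×-dec Q? w) {xs = upToLength} w∈))

  ∈-windowsOf : ∀ {Q : List V → Set} (Q? : Decidable Q) {w} → length w ≡ k → w ∈ windowsOf Q? ⇔ Q w
  ∈-windowsOf Q? l = mk⇔
    (λ w∈ → proj₂ (proj₂ (∈-filter⁻ (λ w → (length w ℕ.≟ k) ×-dec Q? w) {xs = upToLength} w∈)))
    (λ q → ∈-filter⁺ (λ w → (length w ℕ.≟ k) ×-dec Q? w) (upToLength-complete (ℕ.≤-reflexive l)) (l , q))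

  shortWord? : Decidable (λ w → length w < k × Word First Last w)
  shortWord? w = (length w <? k) ×-dec word first? last? w

  -- As `k ≥ 2`, each adjacent pair of a long word lies in some window, so `Follows` can be tested
  -- window by window; `First` is tested only in `B` and `Last` only in `E`.
  description : SLTDesc V k
  description = record
    { B = windowsOf (word first? free?)
    ; I = windowsOf (word free? free?)
    ; E = windowsOf (word free? last?)
    ; F = filter shortWord? upToLength
    ; B-len = windowsOf-length (word first? free?)
    ; I-len = windowsOf-length (word free? free?)
    ; E-len = windowsOf-length (word free? last?)
    ; F-len = All.tabulate λ w∈ → proj₁ (proj₂ (∈-filter⁻ shortWord? {xs = upToLength} w∈)) }

  open SLTDesc description
  open Windows description
  open Equivalence

  private
    take-length : ∀ (w : List V) → k ≤ length w → length (take k w) ≡ k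
    take-length w k≤ = trans (List.length-take k w) (ℕ.m≤n⇒m⊓n≡m k≤)

    windows-exact : ∀ a (w : List V) → k ≤ length (a ∷ w) → length w < k → windows k (a ∷ w) ≡ (a ∷ w) ∷ []
    windows-exact a w k≤ <k = trans (windows-long k a w k≤)
      (cong₂ _∷_ (List.take-all k (a ∷ w) <k) (windows-short k w <k))

  ∈-E : ∀ {a w} → k ≤ length (a ∷ w) → length w < k → (a ∷ w) ∈ E ⇔ Chain Last a w
  ∈-E k≤ <k = mk⇔ (λ e → proj₂ (to wE e)) (λ c → from wE (tt , c))
    where wE = ∈-windowsOf (word free? last?) (ℕ.≤-antisym <k k≤)

  -- Of a window in `I` only the first pair is used, since its other pairs reappear in the next
  -- window; the final window, in `E`, supplies all of its pairs and the end condition.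
  tail-correct : ∀ a w → k ≤ length (a ∷ w) → Tail (windows k (a ∷ w)) ⇔ Chain Last a w
  tail-correct a w k≤ with k ≤? length w
  ... | no k≰ =
    subst (λ ws → Tail ws ⇔ Chain Last a w) (sym (windows-exact a w k≤ (ℕ.≰⇒> k≰))) (∈-E k≤ (ℕ.≰⇒> k≰))
  tail-correct a (c ∷ w) k≤ | yes k≤′ =
    subst (λ ws → Tail ws ⇔ Chain Last a (c ∷ w))
      (sym (trans (windows-long k a (c ∷ w) k≤) (cong (take k (a ∷ c ∷ w) ∷_) (windows-long k c w k≤′))))
      (mk⇔ (λ { (i , r) → proj₁ (proj₂ (to wI i)) , to rest r })
           (λ { (f , ch) → from wI (tt , f , chain-take k-2 c w ch) , from rest ch }))
    where
    rest = subst (λ ws → Tail ws ⇔ Chain Last c w) (windows-long k c w k≤′) (tail-correct c w k≤′)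
    wI = ∈-windowsOf (word free? free?) (take-length (a ∷ c ∷ w) k≤)

  long-correct : ∀ a w → k ≤ length (a ∷ w) → Long (windows k (a ∷ w)) ⇔ Word First Last (a ∷ w)
  long-correct a w k≤ with k ≤? length w
  ... | no k≰ =
    subst (λ ws → Long ws ⇔ Word First Last (a ∷ w)) (sym (windows-exact a w k≤ <k))
      (mk⇔ (λ { (b , e) → proj₁ (to wB b) , to (∈-E k≤ <k) e })
           (λ { (f , ch) → from wB (f , subst (Chain Free a) (List.take-all k w (ℕ.<⇒≤ <k)) (chain-take k a w ch))
                         , from (∈-E k≤ <k) ch }))
    where
    <k = ℕ.≰⇒> k≰
    wB = ∈-windowsOf (word first? free?) (ℕ.≤-antisym <k k≤)
  long-correct a (c ∷ w) k≤ | yes k≤′ =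
    subst (λ ws → Long ws ⇔ Word First Last (a ∷ c ∷ w))
      (sym (trans (windows-long k a (c ∷ w) k≤) (cong (take k (a ∷ c ∷ w) ∷_) (windows-long k c w k≤′))))
      (mk⇔ (λ { (b , r) → let fst , flw , _ = to wB b in fst , flw , to rest r })
           (λ { (fst , flw , ch) → from wB (fst , flw , chain-take k-2 c w ch) , from rest ch }))
    where
    rest = subst (λ ws → Tail ws ⇔ Chain Last c w) (windows-long k c w k≤′) (tail-correct c w k≤′)
    wB = ∈-windowsOf (word first? free?) (take-length (a ∷ c ∷ w) k≤)

  correct : ∀ w → InSLT description w ⇔ Word First Last w
  correct w with k ≤? length w
  correct (a ∷ w) | yes k≤ = mk⇔
    (λ s → to (long-correct a w k≤) (to (inSLT-long {a ∷ w} k≤) s))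
    (λ c → from (inSLT-long {a ∷ w} k≤) (from (long-correct a w k≤) c))
  ... | no k≰ = mk⇔
    (λ s → proj₂ (proj₂ (∈-filter⁻ shortWord? {xs = upToLength} (to (inSLT-short {w} <k) s))))
    (λ c → from (inSLT-short {w} <k) (∈-filter⁺ shortWord? (upToLength-complete (ℕ.<⇒≤ <k)) (<k , c)))
    where <k = ℕ.≰⇒> k≰

-- From context-sensitive to tree-controlled grammars

concatMap-singleton : ∀ {A B : Set} (f : A → B) xs → concatMap (λ x → f x ∷ []) xs ≡ map f xs
concatMap-singleton f []       = refl
concatMap-singleton f (x ∷ xs) = cong (f x ∷_) (concatMap-singleton f xs)

map-lookup-allFin : ∀ {A : Set} (xs : List A) → map (lookup xs) (allFin (length xs)) ≡ xs
map-lookup-allFin xs = trans (List.map-tabulate id (lookup xs)) (List.tabulate-lookup xs)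

word-map : ∀ {A B : Set} {R : B → B → Set} {first last} (f : A → B) w →
           TwoLocal.Word (λ a b → R (f a) (f b)) (first ∘ f) (last ∘ f) w ⇔ TwoLocal.Word R first last (map f w)
word-map f []      = mk⇔ (λ _ → tt) (λ _ → tt)
word-map {R = R} {last = last} f (a ∷ w) = mk⇔ (λ { (p , c) → p , to a w c }) (λ { (p , c) → p , from a w c })
  where
  module X = TwoLocal (λ a b → R (f a) (f b))
  module Y = TwoLocal R
  to : ∀ a w → X.Chain (last ∘ f) a w → Y.Chain last (f a) (map f w)
  to a []      l       = l
  to a (b ∷ w) (p , c) = p , to b w c
  from : ∀ a w → Y.Chain last (f a) (map f w) → X.Chain (last ∘ f) a w
  from a []      l       = l
  from a (b ∷ w) (p , c) = p , from b w c

expand-++ : ∀ {n t} {P : List (Rule n t)} {u u′ v v′} →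
            Expand P u u′ → Expand P v v′ → Expand P (u ++ v) (u′ ++ v′)
expand-++ []         q = q
expand-++ (rule {x = x} {xs} {w′ = w′} r p) q =
  subst (Expand _ _) (sym (List.++-assoc (map live (x ∷ xs)) w′ _)) (rule r (expand-++ p q))
expand-++ (age p)    q = age (expand-++ p q)
expand-++ (keep p)   q = keep (expand-++ p q)

-- Every symbol X of G becomes a nonterminal plain X that may be copied or turned
-- into mark (r , i), the claim to be the i-th symbol of an occurrence of the
-- left-hand side of rule r.  The 2-local control language admits exactly the
-- levels in which the marks form complete left-hand sides.
module ContextToTree {m t : ℕ} (G : CSGrammar m t) (k-2 : ℕ) where
  open CSGrammar G

  -- The symbols of the left-hand side, each with the word that replaces it.
  pieces : CSRule m t → List (Sym m t × List (Sym m t))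
  pieces r = map (λ x → x , x ∷ []) left ++ (inj₁ A , γ) ∷ map (λ x → x , x ∷ []) right
    where open CSRule r

  pieces-lhs : ∀ r → map proj₁ (pieces r) ≡ csLhs r
  pieces-lhs r = trans (List.map-++ proj₁ (map _ left) _)
    (cong₂ (λ u v → u ++ inj₁ A ∷ v) (proj₁-pieces left) (proj₁-pieces right))
    where
    open CSRule r
    proj₁-pieces : ∀ (w : List (Sym m t)) → map proj₁ (map (λ x → x , x ∷ []) w) ≡ w
    proj₁-pieces w = trans (sym (List.map-∘ w)) (List.map-id w)

  pieces-rhs : ∀ r → concatMap proj₂ (pieces r) ≡ csRhs r
  pieces-rhs r = trans (List.concatMap-++ proj₂ (map _ left) _)
    (cong₂ (λ u v → u ++ γ ++ v) (proj₂-pieces left) (proj₂-pieces right))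
    where
    open CSRule r
    proj₂-pieces : ∀ (w : List (Sym m t)) → concatMap proj₂ (map (λ x → x , x ∷ []) w) ≡ w
    proj₂-pieces []      = refl
    proj₂-pieces (x ∷ w) = cong (x ∷_) (proj₂-pieces w)

  RuleIndex : Set
  RuleIndex = Fin (length P)

  piecesAt : RuleIndex → List (Sym m t × List (Sym m t))
  piecesAt r = pieces (lookup P r)

  Position : Set
  Position = Σ RuleIndex λ r → Fin (length (piecesAt r))

  from : Position → Sym m t
  from (r , i) = proj₁ (lookup (piecesAt r) i)

  out : Position → List (Sym m t)
  out (r , i) = proj₂ (lookup (piecesAt r) i)

  data Nonterminal : Set where
    start : Nonterminal
    plain : Sym m t → Nonterminal
    mark  : Position → Nonterminal

  Z : Set
  Z = Nonterminal ⊎ Fin t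

  listable-Position : Listable Position
  listable-Position = listable-Σ (listable-Fin _) λ _ → listable-Fin _

  opaque
    listable-Nonterminal : Listable Nonterminal
    listable-Nonterminal = listable-image
      (λ { (inj₁ tt) → start ; (inj₂ (inj₁ x)) → plain x ; (inj₂ (inj₂ p)) → mark p })
      (λ { start → inj₁ tt , refl ; (plain x) → inj₂ (inj₁ x) , refl ; (mark p) → inj₂ (inj₂ p) , refl })
      (listable-⊎ listable-⊤ (listable-⊎ (listable-Sym m t) listable-Position))

  open Listable listable-Nonterminal using (size; code; decode-code)

  encode : Z → Sym size t
  encode = codeSym listable-Nonterminal

  decode : Sym size t → Z
  decode = decodeSym listable-Nonterminal

  decode-encode : ∀ x → decode (encode x) ≡ x
  decode-encode = decode-codeSym listable-Nonterminal

  decode-encodes : ∀ w → map decode (map encode w) ≡ w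
  decode-encodes w = trans (sym (List.map-∘ w)) (trans (List.map-cong decode-encode w) (List.map-id w))

  -- Whether a block may begin or end with the symbol. A complete left-hand side is a block of
  -- marks, and every other nonterminal is a block by itself.
  First Last : Z → Set
  First (inj₁ (mark (r , i))) = toℕ i ≡ 0
  First (inj₁ _)              = ⊤
  First (inj₂ _)              = ⊥
  Last (inj₁ (mark (r , i)))  = suc (toℕ i) ≡ length (piecesAt r)
  Last (inj₁ _)               = ⊤
  Last (inj₂ _)               = ⊥

  Next : Z → Z → Set
  Next (inj₁ (mark (r , i))) (inj₁ (mark (s , j))) = r ≡ s × toℕ j ≡ suc (toℕ i)
  Next _                     _                     = ⊥

  Follows : Z → Z → Set
  Follows x y = (Last x × First y) ⊎ Next x y

  first? : Decidable First
  first? (inj₁ start)          = yes tt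
  first? (inj₁ (plain _))      = yes tt
  first? (inj₁ (mark (r , i))) = toℕ i ℕ.≟ 0
  first? (inj₂ _)              = no id

  last? : Decidable Last
  last? (inj₁ start)          = yes tt
  last? (inj₁ (plain _))      = yes tt
  last? (inj₁ (mark (r , i))) = suc (toℕ i) ℕ.≟ length (piecesAt r)
  last? (inj₂ _)              = no id

  next? : ∀ x y → Dec (Next x y)
  next? (inj₁ (mark (r , i))) (inj₁ (mark (s , j))) = (r Fin.≟ s) ×-dec (toℕ j ℕ.≟ suc (toℕ i))
  next? (inj₁ (mark _))       (inj₁ start)          = no id
  next? (inj₁ (mark _))       (inj₁ (plain _))      = no id
  next? (inj₁ (mark _))       (inj₂ _)              = no id
  next? (inj₁ start)          _                     = no id
  next? (inj₁ (plain _))      _                     = no id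
  next? (inj₂ _)              _                     = no id

  open TwoLocal Follows using (Chain; Word)

  module Control = TwoLocalSLT (listable-Sym size t)
    {First ∘ decode} {Last ∘ decode} {λ x y → Follows (decode x) (decode y)}
    (first? ∘ decode) (last? ∘ decode)
    (λ x y → (last? (decode x) ×-dec first? (decode y)) ⊎-dec next? (decode x) (decode y)) k-2

  opaque
    control : SLTDesc (Sym size t) (suc (suc k-2))
    control = Control.description

    controlled : ∀ w → InSLT control w ⇔ Word First Last (map decode w)
    controlled w = word-map decode w ⇔-∘ Control.correct w

  -- A rule with empty replacement survives only as the erasing rule `empty` of `start`. A mark
  -- whose output is empty gets no `apply` and is a dead end, so no other node can be erased.
  data Name : Set where
    begin  : Name
    empty  : (r : RuleIndex) → T (null (CSRule.γ (lookup P r))) → Name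
    copy   : Sym m t → Name
    select : Position → Name
    emit   : Fin t → Name
    apply  : (p : Position) → T (not (null (out p))) → Name

  opaque
    listable-Name : Listable Name
    listable-Name = listable-image
      (λ { (inj₁ tt) → begin ; (inj₂ (inj₁ (r , e))) → empty r e ; (inj₂ (inj₂ (inj₁ x))) → copy x
         ; (inj₂ (inj₂ (inj₂ (inj₁ p)))) → select p ; (inj₂ (inj₂ (inj₂ (inj₂ (inj₁ a))))) → emit a
         ; (inj₂ (inj₂ (inj₂ (inj₂ (inj₂ (p , e)))))) → apply p e })
      (λ { begin → inj₁ tt , refl ; (empty r e) → inj₂ (inj₁ (r , e)) , refl ; (copy x) → inj₂ (inj₂ (inj₁ x)) , refl
         ; (select p) → inj₂ (inj₂ (inj₂ (inj₁ p))) , refl ; (emit a) → inj₂ (inj₂ (inj₂ (inj₂ (inj₁ a)))) , refl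
         ; (apply p e) → inj₂ (inj₂ (inj₂ (inj₂ (inj₂ (p , e))))) , refl })
      (listable-⊎ listable-⊤ (listable-⊎ (listable-Σ (listable-Fin _) λ _ → listable-T _)
        (listable-⊎ (listable-Sym m t) (listable-⊎ listable-Position
          (listable-⊎ (listable-Fin t) (listable-Σ listable-Position λ _ → listable-T _))))))

  plains : List (Sym m t) → List Z
  plains = map (inj₁ ∘ plain)

  lhs : Name → Nonterminal
  lhs begin       = start
  lhs (empty _ _) = start
  lhs (copy x)    = plain x
  lhs (select p)  = plain (from p)
  lhs (emit a)    = plain (inj₂ a)
  lhs (apply p _) = mark p

  rhs : Name → List Z
  rhs begin       = plains (inj₁ S ∷ [])
  rhs (empty _ _) = []
  rhs (copy x)    = plains (x ∷ [])
  rhs (select p)  = inj₁ (mark p) ∷ []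
  rhs (emit a)    = inj₂ a ∷ []
  rhs (apply p _) = plains (out p)

  rhs-[] : ∀ i → rhs i ≡ [] → ∃ λ r → ∃ λ e → i ≡ empty r e
  rhs-[] (empty r e) _  = r , e , refl
  rhs-[] (apply p h) e = ⊥-elim (subst (T ∘ not ∘ null) (map-[] _ (out p) e) h)

  start∉rhs : ∀ i → inj₁ start ∉ rhs i
  start∉rhs begin       (here ())
  start∉rhs begin       (there ())
  start∉rhs (copy _)    (here ())
  start∉rhs (copy _)    (there ())
  start∉rhs (select _)  (here ())
  start∉rhs (select _)  (there ())
  start∉rhs (emit _)    (here ())
  start∉rhs (emit _)    (there ())
  start∉rhs (apply p _) s∈ with ∈-map⁻ (inj₁ ∘ plain) s∈
  ... | _ , _ , ()

  treeRule : Name → Rule size t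
  treeRule i = code (lhs i) , map encode (rhs i)

  treeRules : List (Rule size t)
  treeRules = map treeRule (elems listable-Name)

  treeRule∈ : ∀ i → treeRule i ∈ treeRules
  treeRule∈ i = ∈-map⁺ treeRule (complete listable-Name i)

  all-treeRules : {Q : Rule size t → Set} → (∀ i → Q (treeRule i)) → All Q treeRules
  all-treeRules q = All.map⁺ (All.universal q (elems listable-Name))

  grammar : TCGrammarSLT size t (suc (suc k-2))
  grammar = record
    { P = treeRules
    ; S = code start
    ; nonErasing = all-treeRules nonErasing
    ; R = control }
    where
    start∉ : ∀ i → inj₁ (code start) ∉ proj₂ (treeRule i)
    start∉ i s∈ = start∉rhs i (subst₂ _∈_ (decode-encode (inj₁ start)) (decode-encodes (rhs i)) (∈-map⁺ decode s∈))
    nonErasing : ∀ i → proj₂ (treeRule i) ≢ [] ⊎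
                 (code (lhs i) ≡ code start × All (λ r → inj₁ (code start) ∉ proj₂ r) treeRules)
    nonErasing i with rhs i in eq
    ... | _ ∷ _ = inj₁ λ ()
    ... | [] with rhs-[] i eq
    ... | _ , _ , refl = inj₂ (refl , all-treeRules start∉)

  -- From controlled levels to context-sensitive derivations

  open Levels grammar using (LevelStep; Derives)

  -- A mark is read by `meaning` as not yet applied and by `result` as applied. The results of one
  -- level are the meanings of the next, so a level step amounts to a derivation from meanings to
  -- results.
  meaning : Z → Sym m t
  meaning (inj₁ start)     = inj₁ S
  meaning (inj₁ (plain x)) = x
  meaning (inj₁ (mark p))  = from p
  meaning (inj₂ a)         = inj₂ a

  result : Z → List (Sym m t)
  result (inj₁ start)     = inj₁ S ∷ []
  result (inj₁ (plain x)) = x ∷ []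
  result (inj₁ (mark p))  = out p
  result (inj₂ a)         = inj₂ a ∷ []

  infix 4 _⇒_
  _⇒_ = Star (Step G)

  ⇒-∷ : ∀ a {s s′} → s ⇒ s′ → a ∷ s ⇒ a ∷ s′
  ⇒-∷ a = Star.gmap (a ∷_) λ { (step x y r r∈) → step (a ∷ x) y r r∈ }

  ⇒-++ˡ : ∀ u {s s′} → s ⇒ s′ → u ++ s ⇒ u ++ s′
  ⇒-++ˡ []      p = p
  ⇒-++ˡ (a ∷ u) p = ⇒-∷ a (⇒-++ˡ u p)

  fire : ∀ r (i : Fin (length (piecesAt r))) → suc (toℕ i) ≡ length (piecesAt r) → ∀ {s s′} → s ⇒ s′ →
         map proj₁ (take (suc (toℕ i)) (piecesAt r)) ++ s ⇒ concatMap proj₂ (take (suc (toℕ i)) (piecesAt r)) ++ s′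
  fire r i l {s} p rewrite List.take-all (suc (toℕ i)) (piecesAt r) (ℕ.≤-reflexive (sym l))
                         | pieces-lhs (lookup P r) | pieces-rhs (lookup P r) =
    step [] s (lookup P r) (∈-lookup r) ◅ ⇒-++ˡ (csRhs (lookup P r)) p

  take-position : ∀ r (i : Fin (length (piecesAt r))) →
    take (suc (toℕ i)) (piecesAt r) ≡ take (toℕ i) (piecesAt r) ++ (from (r , i) , out (r , i)) ∷ []
  take-position r i = List.take-suc (piecesAt r) i

  mutual
    word-sound : ∀ w → Word First Last w → map meaning w ⇒ concatMap result w
    word-sound []                          _       = ε
    word-sound (inj₁ start ∷ w)            (_ , c) = ⇒-∷ _ (chain-sound w (λ ()) c)
    word-sound (inj₁ (plain x) ∷ w)        (_ , c) = ⇒-∷ _ (chain-sound w (λ ()) c)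
    word-sound (inj₁ (mark (r , i)) ∷ w)   (f , c) =
      subst₂ _⇒_ (cong (λ q → map proj₁ q ++ map meaning w) one)
        (trans (cong (λ q → concatMap proj₂ q ++ concatMap result w) one)
               (cong (_++ concatMap result w) (List.++-identityʳ (out (r , i)))))
        (block-sound r i w c)
      where
      -- A block begins at position 0, so the prefix read so far is this one piece.
      one : take (suc (toℕ i)) (piecesAt r) ≡ (from (r , i) , out (r , i)) ∷ []
      one = trans (take-position r i) (cong (λ j → take j (piecesAt r) ++ (from (r , i) , out (r , i)) ∷ []) f)

    chain-sound : ∀ {x} w → (∀ {y} → ¬ Next x y) → Chain Last x w → map meaning w ⇒ concatMap result w
    chain-sound []      ¬n _                 = ε
    chain-sound (y ∷ w) ¬n (inj₂ n , _)       = ⊥-elim (¬n n)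
    chain-sound (y ∷ w) ¬n (inj₁ (_ , f) , c) = word-sound (y ∷ w) (f , c)

    -- An unfinished block cannot be rewritten, so the pieces read so far are carried along,
    -- unreplaced on the left and replaced on the right, until the last mark; there the rule is
    -- applied once by `fire`.
    block-sound : ∀ r i w → Chain Last (inj₁ (mark (r , i))) w →
      map proj₁ (take (suc (toℕ i)) (piecesAt r)) ++ map meaning w ⇒
      concatMap proj₂ (take (suc (toℕ i)) (piecesAt r)) ++ concatMap result w
    block-sound r i []      l                  = fire r i l ε
    block-sound r i (y ∷ w) (inj₁ (l , f) , c) = fire r i l (word-sound (y ∷ w) (f , c))
    block-sound r i (inj₁ (mark (.r , j)) ∷ w) (inj₂ (refl , j≡) , c) =
      subst₂ _⇒_
        (trans (cong (λ q → map proj₁ q ++ map meaning w) extend)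
          (trans (cong (_++ map meaning w) (List.map-++ proj₁ (take (suc (toℕ i)) (piecesAt r)) _))
                 (List.++-assoc (map proj₁ (take (suc (toℕ i)) (piecesAt r))) _ _)))
        (trans (cong (λ q → concatMap proj₂ q ++ concatMap result w) extend)
          (trans (cong (_++ concatMap result w) (trans (List.concatMap-++ proj₂ (take (suc (toℕ i)) (piecesAt r)) _)
                   (cong (concatMap proj₂ (take (suc (toℕ i)) (piecesAt r)) ++_) (List.++-identityʳ (out (r , j))))))
                 (List.++-assoc (concatMap proj₂ (take (suc (toℕ i)) (piecesAt r))) _ _)))
        (block-sound r j w c)
      where
      extend : take (suc (toℕ j)) (piecesAt r) ≡
               take (suc (toℕ i)) (piecesAt r) ++ (from (r , j) , out (r , j)) ∷ []
      extend = trans (take-position r j) (cong (λ l → take l (piecesAt r) ++ (from (r , j) , out (r , j)) ∷ []) j≡)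

  meanings : List (Sym size t) → List (Sym m t)
  meanings w = map meaning (map decode w)

  results : List (Sym size t) → List (Sym m t)
  results w = concatMap result (map decode w)

  meanings-++ : ∀ u v → meanings (u ++ v) ≡ meanings u ++ meanings v
  meanings-++ u v = trans (cong (map meaning) (List.map-++ decode u v)) (List.map-++ meaning (map decode u) _)

  meanings-plains : ∀ w → map meaning (plains w) ≡ w
  meanings-plains w = trans (sym (List.map-∘ w)) (List.map-id w)

  name-sound : ∀ i → rhs i ≢ [] → map meaning (rhs i) ≡ result (inj₁ (lhs i))
  name-sound begin       _  = refl
  name-sound (empty _ _) ne = ⊥-elim (ne refl)
  name-sound (copy _)    _  = refl
  name-sound (select _)  _  = refl
  name-sound (emit _)    _  = refl
  name-sound (apply p _) _  = meanings-plains (out p)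

  IsNonterminal : Z → Set
  IsNonterminal (inj₁ _) = ⊤
  IsNonterminal (inj₂ _) = ⊥

  word-nonterminals : ∀ w → Word First Last w → All IsNonterminal w
  word-nonterminals []      _       = []
  word-nonterminals (x ∷ w) (f , c) = first-nonterminal x f ∷ chain-nonterminals x w c
    where
    first-nonterminal : ∀ x → First x → IsNonterminal x
    first-nonterminal (inj₁ _) _ = tt

    next-nonterminal : ∀ x y → Next x y → IsNonterminal y
    next-nonterminal x (inj₁ _) _ = tt
    next-nonterminal (inj₁ start)     (inj₂ _) ()
    next-nonterminal (inj₁ (plain _)) (inj₂ _) ()
    next-nonterminal (inj₁ (mark _))  (inj₂ _) ()
    next-nonterminal (inj₂ _)         (inj₂ _) ()

    chain-nonterminals : ∀ x w → Chain Last x w → All IsNonterminal w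
    chain-nonterminals x []      _                  = []
    chain-nonterminals x (y ∷ w) (inj₁ (_ , f) , c) = first-nonterminal y f ∷ chain-nonterminals y w c
    chain-nonterminals x (y ∷ w) (inj₂ n , c)       = next-nonterminal x y n ∷ chain-nonterminals y w c

  -- Controlled levels contain no terminals, so no cell ages and the cuts consist of live cells
  -- throughout.
  expand-sound : ∀ w {v} → All IsNonterminal (map decode w) → Expand treeRules (map live w) v →
                 ∃ λ w′ → v ≡ map live w′ × meanings w′ ≡ results w
  expand-sound [] _ [] = [] , refl , refl
  expand-sound (inj₂ _ ∷ w) (() ∷ _) _
  expand-sound (inj₁ A ∷ w) (_ ∷ ns) (rule {x = x} {xs} r∈ p) with expand-sound w ns p | ∈-map⁻ treeRule r∈
  ... | w′ , refl , e | i , _ , eq =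
    (x ∷ xs) ++ w′ , sym (List.map-++ live (x ∷ xs) w′) ,
    trans (meanings-++ (x ∷ xs) w′) (cong₂ _++_ produced e)
    where
    nonempty : rhs i ≢ []
    nonempty e with () ← trans (cong proj₂ eq) (cong (map encode) e)

    produced : meanings (x ∷ xs) ≡ result (decode (inj₁ A))
    produced = trans (cong meanings (cong proj₂ eq)) (trans (cong (map meaning) (decode-encodes (rhs i)))
      (trans (name-sound i nonempty)
        (cong result (sym (trans (cong (decode ∘ inj₁ ∘ proj₁) eq) (decode-encode (inj₁ (lhs i))))))))

  levels-sound : ∀ w {v} → Star LevelStep (map live w) v → ∃ λ w′ → v ≡ map live w′ × (meanings w ⇒ meanings w′)
  levels-sound w ε = w , refl , ε
  levels-sound w ((x , c) ◅ ps) with Equivalence.to (controlled w) (subst (InSLT control) (live-map w) c)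
    where
    live-map : ∀ w → liveSyms (map live w) ≡ w
    live-map []      = refl
    live-map (x ∷ w) = cong (x ∷_) (live-map w)
  ... | wd with expand-sound w (word-nonterminals (map decode w) wd) x
  ... | w₁ , refl , e with levels-sound w₁ ps
  ... | w′ , e′ , q = w′ , e′ , subst (meanings w ⇒_) (sym e) (word-sound (map decode w) wd) ◅◅ q

  terms-sound : ∀ w {z} → Terms (map live w) z → meanings w ≡ map inj₂ z
  terms-sound []           []        = refl
  terms-sound (inj₂ a ∷ w) (live∷ p) = cong (_ ∷_) (terms-sound w p)

  null→[] : ∀ {A : Set} (xs : List A) → T (null xs) → xs ≡ []
  null→[] [] _ = refl

  λ-rule : ∀ {r} → r ∈ P → CSRule.γ r ≡ [] →
           CSRule.A r ≡ S × CSRule.left r ≡ [] × CSRule.right r ≡ [] × All (λ r′ → inj₁ S ∉ csRhs r′) P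
  λ-rule r∈ γ≡ with All.lookup wf r∈
  ... | inj₁ ne = ⊥-elim (ne γ≡)
  ... | inj₂ h  = h

  λ-step : ∀ {r} → r ∈ P → CSRule.γ r ≡ [] → Step G (inj₁ S ∷ []) []
  λ-step {csrule _ _ _ _} r∈ refl with λ-rule r∈ refl
  ... | refl , refl , refl , _ = step [] [] _ r∈

  sound : ∀ z → Derives z → CSLang G z
  sound z (inj₁ (refl , s∈ , _)) with ∈-map⁻ treeRule s∈
  ... | i , _ , eq with rhs-[] i (map-[] encode (rhs i) (sym (cong proj₂ eq)))
  ... | r , e , _ = λ-step (∈-lookup r) (null→[] (CSRule.γ (lookup P r)) e) ◅ ε
  sound z (inj₂ (v , st , tm)) with levels-sound (inj₁ (code start) ∷ []) st
  ... | w , refl , d =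
    subst₂ _⇒_ (cong (λ x → meaning x ∷ []) (decode-encode (inj₁ start))) (terms-sound w tm) d

  -- From context-sensitive derivations to controlled levels

  data Step⁺ : List (Sym m t) → List (Sym m t) → Set where
    step⁺ : ∀ x y r → CSRule.γ (lookup P r) ≢ [] →
            Step⁺ (x ++ csLhs (lookup P r) ++ y) (x ++ csRhs (lookup P r) ++ y)

  HasλRule : Set
  HasλRule = ∃ λ r → r ∈ P × CSRule.γ r ≡ []

  -- In the presence of a λ-rule the start symbol never occurs again.
  Fresh : List (Sym m t) → Set
  Fresh s = s ≡ inj₁ S ∷ [] ⊎ (HasλRule → inj₁ S ∉ s)

  lhs-nonempty : ∀ (r : CSRule m t) → ∃ λ a → ∃ λ l → csLhs r ≡ a ∷ l
  lhs-nonempty (csrule []      A _ _) = inj₁ A , _ , refl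
  lhs-nonempty (csrule (a ∷ l) A _ _) = a , _ , refl

  singleton-context : ∀ x y (r : CSRule m t) {a} → x ++ csLhs r ++ y ≡ a ∷ [] → x ≡ [] × y ≡ []
  singleton-context x y r e with lhs-nonempty r
  ... | b , l , eq with ++-singleton x {l = l} (trans (cong (λ q → x ++ q ++ y) (sym eq)) e)
  ... | refl , _ , _ , refl = refl , refl

  ∉[] : ∀ {A : Set} {a : A} {xs} → xs ≡ [] → a ∉ xs
  ∉[] refl ()

  -- The right-hand side is free of `S` by well-formedness. The context is empty if the old word was
  -- `S` alone, and otherwise free of `S` as part of the old word.
  fresh-step : ∀ x y {r} → r ∈ P → Fresh (x ++ csLhs r ++ y) → HasλRule → inj₁ S ∉ x ++ csRhs r ++ y
  fresh-step x y {r} r∈ fr (r₀ , r₀∈ , γ≡) S∈ with ∈-++⁻ x S∈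
  ... | inj₁ S∈x = absent fr
    where
    absent : Fresh (x ++ csLhs r ++ y) → ⊥
    absent (inj₁ e) = ∉[] (proj₁ (singleton-context x y r e)) S∈x
    absent (inj₂ S∉) = S∉ (r₀ , r₀∈ , γ≡) (∈-++⁺ˡ S∈x)
  ... | inj₂ S∈ry with ∈-++⁻ (csRhs r) S∈ry
  ... | inj₁ S∈r = All.lookup (proj₂ (proj₂ (proj₂ (λ-rule r₀∈ γ≡)))) r∈ S∈r
  ... | inj₂ S∈y = absent fr
    where
    absent : Fresh (x ++ csLhs r ++ y) → ⊥
    absent (inj₁ e) = ∉[] (proj₂ (singleton-context x y r e)) S∈y
    absent (inj₂ S∉) = S∉ (r₀ , r₀∈ , γ≡) (∈-++⁺ʳ x (∈-++⁺ʳ (csLhs r) S∈y))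

  []-stuck : ∀ {s} → [] ⇒ s → s ≡ []
  []-stuck ε        = refl
  []-stuck (p ◅ ps) = ⊥-elim (no-step p refl)
    where
    no-step : ∀ {s s′} → Step G s s′ → s ≢ []
    no-step (step (_ ∷ _) _ _ _) ()
    no-step (step [] y r _) e with lhs-nonempty r
    ... | _ , _ , eq with () ← trans (cong (_++ y) (sym eq)) e

  -- A λ-rule rewrites `S`, which by freshness must then be the whole word. The result is the empty
  -- word, from which no step is possible.
  separate-λ : ∀ z {s} → Fresh s → s ⇒ map inj₂ z → (z ≡ [] × HasλRule) ⊎ Star Step⁺ s (map inj₂ z)
  separate-λ z fr ε = inj₂ ε
  separate-λ z fr (step x y r r∈ ◅ ps) with CSRule.γ r in γ≡
  ... | [] = inj₁ (erased fr (λ-rule r∈ γ≡) , r , r∈ , γ≡)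
    where
    erased : Fresh (x ++ csLhs r ++ y) → _ → z ≡ []
    erased (inj₂ S∉) (refl , refl , refl , _) = ⊥-elim (S∉ (r , r∈ , γ≡) (∈-++⁺ʳ x (here refl)))
    erased (inj₁ e)  (_ , l≡ , r≡ , _) with singleton-context x y r e
    ... | refl , refl = map-[] inj₂ z ([]-stuck (subst (_⇒ map inj₂ z)
      (trans (List.++-identityʳ _) (cong₂ (λ u v → u ++ v) l≡ r≡)) ps))
  ... | a ∷ g
    with separate-λ z
           (inj₂ (subst (λ u → HasλRule → inj₁ S ∉ x ++ (CSRule.left r ++ u ++ CSRule.right r) ++ y) γ≡
                        (fresh-step x y r∈ fr))) ps
  ... | inj₁ h = inj₁ h
  ... | inj₂ q = inj₂ (subst₂ Step⁺
    (cong (λ r → x ++ csLhs r ++ y) (sym (lookup-index r∈)))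
    (trans (cong (λ r → x ++ csRhs r ++ y) (sym (lookup-index r∈)))
           (cong (λ u → x ++ (CSRule.left r ++ u ++ CSRule.right r) ++ y) γ≡))
    (step⁺ x y (index r∈) (λ e → case-∷ (trans (sym γ≡) (trans (cong CSRule.γ (lookup-index r∈)) e)))) ◅ q)
    where
    case-∷ : a ∷ g ≢ []
    case-∷ ()

  cells : List Z → List (Cell size t)
  cells w = map live (map encode w)

  cells-++ : ∀ u v → cells (u ++ v) ≡ cells u ++ cells v
  cells-++ u v = trans (cong (map live) (List.map-++ encode u v)) (List.map-++ live (map encode u) _)

  -- A level is expanded by choosing a rule for each of its cells; beginning, copying, selecting,
  -- applying and emitting are all instances.
  expand-names : {I : Set} (name : I → Name) → (∀ i → rhs (name i) ≢ []) → ∀ is →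
                 Expand treeRules (cells (map (inj₁ ∘ lhs ∘ name) is)) (cells (concatMap (rhs ∘ name) is))
  expand-names name ne []       = []
  expand-names name ne (i ∷ is) =
    subst (Expand treeRules _) (sym (cells-++ (rhs (name i)) _)) (expand-one (name i) (ne i) (expand-names name ne is))
    where
    expand-one : ∀ j {w w′} → rhs j ≢ [] → Expand treeRules w w′ →
                 Expand treeRules (live (inj₁ (code (lhs j))) ∷ w) (cells (rhs j) ++ w′)
    expand-one j ne p with rhs j | treeRule∈ j
    ... | []    | _  = ⊥-elim (ne refl)
    ... | _ ∷ _ | r∈ = rule r∈ p

  level-step : ∀ w {v} → Word First Last w → Expand treeRules (cells w) v → LevelStep (cells w) v
  level-step w wd x = x , subst (InSLT control) (sym (live-cells w))
    (Equivalence.from (controlled (map encode w)) (subst (Word First Last) (sym (decode-encodes w)) wd))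
    where
    live-cells : ∀ w → liveSyms (cells w) ≡ map encode w
    live-cells []      = refl
    live-cells (x ∷ w) = cong (encode x ∷_) (live-cells w)

  word-++ : ∀ u v → Word First Last u → Word First Last v → Word First Last (u ++ v)
  word-++ []      v _       q = q
  word-++ (x ∷ u) v (f , c) q = f , chain-++ x u v c q
    where
    chain-++ : ∀ x u v → Chain Last x u → Word First Last v → Chain Last x (u ++ v)
    chain-++ x (y ∷ u) v       (p , c) q       = p , chain-++ y u v c q
    chain-++ x []      []      l       _       = l
    chain-++ x []      (_ ∷ _) l       (f , c) = inj₁ (l , f) , c

  plains-word : ∀ w → Word First Last (plains w)
  plains-word []      = tt
  plains-word (x ∷ w) = word-++ (inj₁ (plain x) ∷ []) (plains w) (tt , tt) (plains-word w)

  tabulate-word : ∀ d (f : Fin d → Z) → (∀ i → toℕ i ≡ 0 → First (f i)) →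
                  (∀ i j → toℕ j ≡ suc (toℕ i) → Follows (f i) (f j)) →
                  (∀ i → suc (toℕ i) ≡ d → Last (f i)) → Word First Last (tabulate f)
  tabulate-word zero    f _   _    _   = tt
  tabulate-word (suc d) f fst flw  lst = fst zero refl , tabulate-chain d f flw lst
    where
    tabulate-chain : ∀ d (f : Fin (suc d) → Z) → (∀ i j → toℕ j ≡ suc (toℕ i) → Follows (f i) (f j)) →
                     (∀ i → suc (toℕ i) ≡ suc d → Last (f i)) → Chain Last (f zero) (tabulate (f ∘ suc))
    tabulate-chain zero    f flw lst = lst zero refl
    tabulate-chain (suc d) f flw lst = flw zero (suc zero) refl ,
      tabulate-chain d (f ∘ suc) (λ i j e → flw (suc i) (suc j) (cong suc e)) (λ i e → lst (suc i) (cong suc e))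

  positions : ∀ r → List (Fin (length (piecesAt r)))
  positions r = allFin (length (piecesAt r))

  marks : RuleIndex → List Z
  marks r = map (λ i → inj₁ (mark (r , i))) (positions r)

  marks-word : ∀ r → Word First Last (marks r)
  marks-word r = subst (Word First Last) (sym (List.map-tabulate id _))
    (tabulate-word _ _ (λ _ e → e) (λ _ _ e → inj₂ (refl , e)) (λ _ e → e))

  expand-copy : ∀ w → Expand treeRules (cells (plains w)) (cells (plains w))
  expand-copy w = subst (Expand treeRules _) (cong cells (concatMap-singleton (inj₁ ∘ plain) w))
    (expand-names copy (λ _ ()) w)

  expand-select : ∀ r → Expand treeRules (cells (plains (csLhs (lookup P r)))) (cells (marks r))
  expand-select r = subst₂ (Expand treeRules)
    (cong cells (trans (trans (List.map-∘ (positions r))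
                              (cong plains (trans (List.map-∘ (positions r))
                                                  (cong (map proj₁) (map-lookup-allFin (piecesAt r))))))
                       (cong plains (pieces-lhs (lookup P r)))))
    (cong cells (concatMap-singleton (λ i → inj₁ (mark (r , i))) (positions r)))
    (expand-names (λ i → select (r , i)) (λ _ ()) (positions r))

  out-nonempty : ∀ r → CSRule.γ (lookup P r) ≢ [] → ∀ i → out (r , i) ≢ []
  out-nonempty r ne i = All.lookup {P = λ p → proj₂ p ≢ []}
    (All.++⁺ (All.map⁺ (All.universal (λ _ ()) left)) (ne ∷ All.map⁺ (All.universal (λ _ ()) right)))
    (∈-lookup {xs = piecesAt r} i)
    where open CSRule (lookup P r)

  expand-apply : ∀ r → CSRule.γ (lookup P r) ≢ [] →
                 Expand treeRules (cells (marks r)) (cells (plains (csRhs (lookup P r))))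
  expand-apply r ne = subst (Expand treeRules (cells (marks r))) (cong cells outs)
    (expand-names (λ i → apply (r , i) (non-null (out-nonempty r ne i)))
                  (λ i e → out-nonempty r ne i (map-[] _ _ e)) (positions r))
    where
    non-null : ∀ {A : Set} {xs : List A} → xs ≢ [] → T (not (null xs))
    non-null {xs = []}    ne = ne refl
    non-null {xs = _ ∷ _} _  = tt

    outs : concatMap (λ i → plains (out (r , i))) (positions r) ≡ plains (csRhs (lookup P r))
    outs = trans (sym (List.map-concatMap (inj₁ ∘ plain) (λ i → out (r , i)) (positions r)))
      (cong plains (trans (sym (List.concatMap-map proj₂ (lookup (piecesAt r)) (positions r)))
        (trans (cong (concatMap proj₂) (map-lookup-allFin (piecesAt r))) (pieces-rhs (lookup P r)))))

  expand-context : ∀ x y {l l′} → Expand treeRules (cells l) (cells l′) →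
                   Expand treeRules (cells (plains x ++ l ++ plains y)) (cells (plains x ++ l′ ++ plains y))
  expand-context x y {l} {l′} p = subst₂ (Expand treeRules) (sym (cells-context l)) (sym (cells-context l′))
    (expand-++ (expand-copy x) (expand-++ p (expand-copy y)))
    where
    cells-context : ∀ l → cells (plains x ++ l ++ plains y) ≡ cells (plains x) ++ cells l ++ cells (plains y)
    cells-context l = trans (cells-++ (plains x) _) (cong (cells (plains x) ++_) (cells-++ l _))

  plains-context : ∀ x l y → plains (x ++ l ++ y) ≡ plains x ++ plains l ++ plains y
  plains-context x l y = trans (List.map-++ _ x _) (cong (plains x ++_) (List.map-++ _ l y))

  simulate-step : ∀ {s s′} → Step⁺ s s′ → Star LevelStep (cells (plains s)) (cells (plains s′))
  simulate-step (step⁺ x y r ne) =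
    subst₂ (Star LevelStep) (cong cells (sym (plains-context x l y))) (cong cells (sym (plains-context x l′ y)))
      (level-step (plains x ++ plains l ++ plains y)
         (word-++ (plains x) _ (plains-word x) (word-++ (plains l) _ (plains-word l) (plains-word y)))
         (expand-context x y (expand-select r))
       ◅ level-step (plains x ++ marks r ++ plains y)
         (word-++ (plains x) _ (plains-word x) (word-++ (marks r) _ (marks-word r) (plains-word y)))
         (expand-context x y (expand-apply r ne))
       ◅ ε)
    where
    l = csLhs (lookup P r)
    l′ = csRhs (lookup P r)

  simulate : ∀ {s s′} → Star Step⁺ s s′ → Star LevelStep (cells (plains s)) (cells (plains s′))
  simulate ε        = ε
  simulate (p ◅ ps) = simulate-step p ◅◅ simulate ps

  expand-emit : ∀ z → Expand treeRules (cells (plains (map inj₂ z))) (cells (map inj₂ z))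
  expand-emit z = subst₂ (Expand treeRules)
    (cong cells (List.map-∘ z)) (cong cells (concatMap-singleton inj₂ z)) (expand-names emit (λ _ ()) z)

  terms-cells : ∀ z → Terms (cells (map inj₂ z)) z
  terms-cells []      = []
  terms-cells (a ∷ z) = live∷ terms-cells z

  []-controlled : InSLT control (inj₁ (code start) ∷ [])
  []-controlled = Equivalence.from (controlled (inj₁ (code start) ∷ []))
    (subst (λ x → Word First Last (x ∷ [])) (sym (decode-encode (inj₁ start))) (tt , tt))

  derives : ∀ z → CSLang G z → Derives z
  derives z d with separate-λ z (inj₁ refl) d
  ... | inj₁ (z≡ , r , r∈ , γ≡) = inj₁ (z≡ , treeRule∈ (empty (index r∈) isNull) , []-controlled)
    where
    isNull : T (null (CSRule.γ (lookup P (index r∈))))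
    isNull = subst (λ r → T (null (CSRule.γ r))) (lookup-index r∈) (subst (T ∘ null) (sym γ≡) tt)
  ... | inj₂ d⁺ = inj₂ (_ ,
    -- One level leaves `start`, each rule takes two, and a final one emits all terminals together,
    -- so that they occur only in the last, uncontrolled cut.
    (level-step (inj₁ start ∷ []) (tt , tt) (expand-names {I = ⊤} (λ _ → begin) (λ _ ()) (tt ∷ []))
     ◅ simulate d⁺ ◅◅ (level-step (plains (map inj₂ z)) (plains-word _) (expand-emit z) ◅ ε)) , terms-cells z)

  language : ∀ z → CSLang G z ⇔ TCLang grammar z
  language z = ⇔-sym (Levels.language grammar z) ⇔-∘ mk⇔ (derives z) (sound z)

CS⊆TC : ∀ {k t L} → 2 ≤ k → InCS t L → InTC-SLTk k t L
CS⊆TC {suc (suc k-2)} _ (m , G , L⇔) = _ , ContextToTree.grammar G k-2 , λ z →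
  ContextToTree.language G k-2 z ⇔-∘ L⇔ z
CS⊆TC {suc zero} (s≤s ())

theorem22 : ((k : ℕ) → 2 ≤ k → (t : ℕ) (L : List (Fin t) → Set) → InTC-SLTk k t L ⇔ InCS t L)
    × ((t : ℕ) (L : List (Fin t) → Set) → InTC-SLT t L ⇔ InCS t L)
theorem22 =
  (λ k k≥2 t L → mk⇔ (TC⊆CS (ℕ.≤-trans (s≤s z≤n) k≥2)) (CS⊆TC k≥2)) ,
  -- The witness 2 is the least window length to which `CS⊆TC` applies, while `TC⊆CS` covers every
  -- `k ≥ 1` of the union.
  (λ t L → mk⇔ (λ (k , k≥1 , tc) → TC⊆CS k≥1 tc) (λ cs → 2 , s≤s z≤n , CS⊆TC ℕ.≤-refl cs))
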